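{- For every $n_0\in\mathbb{N}$ and every integer $\Delta\geq 3$ there exist $n\geq n_0$ and a connected $\Delta$-regular graph $G$ on $n$ vertices such that, if $\alpha$ is chosen uniformly at random from the set $\Omega(G)$ of proper $(\Delta+1)$-colourings of $G$, then $$\mathbb{P}(\alpha\text{ is frozen})\geq e^{ -\frac{3\log(\Delta)}{\Delta}\cdot n}.$$
   Context: All graphs are finite, simple and labeled. A (proper) $k$-colouring of $G$ is a function $\alpha:V(G)\to[k]$ with $\alpha(x)\neq\alpha(y)$ for every edge $xy$. For $G$ of maximum degree $\Delta$, a proper $(\Delta+1)$-colouring of $G$ is frozen if for every vertex $v$ all $\Delta+1$ colours appear in the closed neighbourhood $N[v]=N(v)\cup\{v\}$. $\log$ is the natural logarithm. -}

module Defs where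

open import Level using (0ℓ)
open import Data.Nat.Base as ℕ using (ℕ; zero; suc; _!)
import Data.Nat.Properties as ℕ
import Data.Nat.Solver
open import Data.Integer.Base as ℤ using (+_; -[1+_])
import Data.Integer.Properties as ℤ
open import Data.Rational renaming (∣_∣ to abs)
open import Data.Rational.Properties
open import Data.Rational.Unnormalised.Base as ℚᵘ using (mkℚᵘ; *≡*; *≤*)
import Data.Rational.Unnormalised.Properties as ℚᵘ
import Data.Rational.Solver
open import Algebra.Definitions.RawSemiring +-*-rawSemiring using (_^_)
open import Data.Fin.Base using (Fin; finToFun)
import Data.Fin.Properties as Fin
open import Data.List.Base using (List; []; _∷_; length; filter; map; allFin)
open import Data.Product using (∃; _×_; _,_; proj₁; proj₂)
open import Data.Sum.Base using (_⊎_; inj₁; inj₂)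
open import Relation.Binary.Core using (Rel)
open import Relation.Binary.Definitions using (Decidable; Symmetric; Irreflexive)
open import Relation.Binary.Construct.Closure.ReflexiveTransitive using (Star)
open import Relation.Binary.PropositionalEquality
open import Relation.Nullary.Decidable using (¬?; _×-dec_; _⊎-dec_; _→-dec_)
open import Relation.Unary as Unary using (Pred)

open Data.Rational.Solver.+-*-Solver using (solve; _:+_; _:*_; _:-_; :-_; _:=_; con)

private
  toℚᵘ-/ : ∀ i d → toℚᵘ (i / suc d) ℚᵘ.≃ mkℚᵘ i d
  toℚᵘ-/ i d = toℚᵘ-fromℚᵘ (mkℚᵘ i d)

  /-≤ : ∀ a b c d .{{_ : ℕ.NonZero b}} .{{_ : ℕ.NonZero d}} →
        a ℕ.* d ℕ.≤ c ℕ.* b → + a / b ≤ + c / d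
  /-≤ a (suc b) c (suc d) h = toℚᵘ-cancel-≤
    (ℚᵘ.≤-respˡ-≃ (ℚᵘ.≃-sym (toℚᵘ-/ (+ a) b))
      (ℚᵘ.≤-respʳ-≃ (ℚᵘ.≃-sym (toℚᵘ-/ (+ c) d))
        (*≤* (subst₂ ℤ._≤_ (ℤ.pos-* a (suc d)) (ℤ.pos-* c (suc b)) (ℤ.+≤+ h)))))

  /-≡ : ∀ a b c d .{{_ : ℕ.NonZero b}} .{{_ : ℕ.NonZero d}} →
        a ℕ.* d ≡ c ℕ.* b → + a / b ≡ + c / d
  /-≡ a b c d e = ≤-antisym (/-≤ a b c d (ℕ.≤-reflexive e))
                            (/-≤ c d a b (ℕ.≤-reflexive (sym e)))

  /-* : ∀ a b c d .{{_ : ℕ.NonZero b}} .{{_ : ℕ.NonZero d}} .{{_ : ℕ.NonZero (b ℕ.* d)}} →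
        (+ a / b) * (+ c / d) ≡ + (a ℕ.* c) / (b ℕ.* d)
  /-* a (suc b) c (suc d) = toℚᵘ-injective (begin
    toℚᵘ ((+ a / suc b) * (+ c / suc d))           ≈⟨ toℚᵘ-homo-* (+ a / suc b) (+ c / suc d) ⟩
    toℚᵘ (+ a / suc b) ℚᵘ.* toℚᵘ (+ c / suc d)     ≈⟨ ℚᵘ.*-cong (toℚᵘ-/ (+ a) b) (toℚᵘ-/ (+ c) d) ⟩
    mkℚᵘ (+ a) b ℚᵘ.* mkℚᵘ (+ c) d                 ≈⟨ ℚᵘ.≃-reflexive (cong (λ z → mkℚᵘ z (d ℕ.+ b ℕ.* suc d)) (sym (ℤ.pos-* a c))) ⟩
    mkℚᵘ (+ (a ℕ.* c)) (d ℕ.+ b ℕ.* suc d)         ≈⟨ toℚᵘ-/ (+ (a ℕ.* c)) _ ⟨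
    toℚᵘ (+ (a ℕ.* c) / (suc b ℕ.* suc d))         ∎)
    where open ℚᵘ.≃-Reasoning

  suc/1 : ∀ n → + suc n / 1 ≡ 1ℚ + (+ n / 1)
  suc/1 n = toℚᵘ-injective (begin
    toℚᵘ (+ suc n / 1)            ≈⟨ toℚᵘ-/ (+ suc n) 0 ⟩
    mkℚᵘ (+ suc n) 0              ≈⟨ *≡* (cong (ℤ._* + 1) (cong (λ z → + 1 ℤ.+ z) (sym (ℤ.*-identityʳ (+ n))))) ⟩
    mkℚᵘ (+ 1) 0 ℚᵘ.+ mkℚᵘ (+ n) 0 ≈⟨ ℚᵘ.+-cong (ℚᵘ.≃-refl {mkℚᵘ (+ 1) 0}) (toℚᵘ-/ (+ n) 0) ⟨
    toℚᵘ 1ℚ ℚᵘ.+ toℚᵘ (+ n / 1)   ≈⟨ toℚᵘ-homo-+ 1ℚ (+ n / 1) ⟨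
    toℚᵘ (1ℚ + (+ n / 1))         ∎)
    where open ℚᵘ.≃-Reasoning

  0≤/ : ∀ a b .{{_ : ℕ.NonZero b}} → 0ℚ ≤ + a / b
  0≤/ a b = /-≤ 0 1 a b ℕ.z≤n

  *-mono : ∀ {p q r s} → 0ℚ ≤ q → 0ℚ ≤ r → p ≤ q → r ≤ s → p * r ≤ q * s
  *-mono {p} {q} {r} {s} 0≤q 0≤r h k =
    ≤-trans (*-monoʳ-≤-nonNeg r {{nonNegative 0≤r}} h) (*-monoˡ-≤-nonNeg q {{nonNegative 0≤q}} k)

  0≤* : ∀ {p q} → 0ℚ ≤ p → 0ℚ ≤ q → 0ℚ ≤ p * q
  0≤* {p} {q} h k = ≤-trans (≤-reflexive (sym (*-zeroˡ q))) (*-monoʳ-≤-nonNeg q {{nonNegative k}} h)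

  0≤+ : ∀ {p q} → 0ℚ ≤ p → 0ℚ ≤ q → 0ℚ ≤ p + q
  0≤+ h k = ≤-trans (≤-reflexive (sym (+-identityˡ 0ℚ))) (+-mono-≤ h k)

  p≤p+q : ∀ p {q} → 0ℚ ≤ q → p ≤ p + q
  p≤p+q p h = ≤-trans (≤-reflexive (sym (+-identityʳ p))) (+-monoʳ-≤ p h)

  p≤q+p : ∀ p {q} → 0ℚ ≤ q → p ≤ q + p
  p≤q+p p {q} h = ≤-trans (p≤p+q p h) (≤-reflexive (+-comm p q))

  ∣-∣-sym : ∀ p q → abs (p - q) ≡ abs (q - p)
  ∣-∣-sym p q = trans (sym (∣-p∣≡∣p∣ (p - q)))
    (cong abs (solve 2 (λ p q → :- (p :- q) := q :- p) refl p q))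

  p≤∣p∣ : ∀ p → p ≤ abs p
  p≤∣p∣ p with ≤-total 0ℚ p
  ... | inj₁ h = ≤-reflexive (sym (0≤p⇒∣p∣≡p h))
  ... | inj₂ h = ≤-trans h (0≤∣p∣ p)

  archimedean : ∀ C ε → 0ℚ < ε → ∃ λ N → ∀ k → N ℕ.≤ k → C * (+ 1 / suc k) ≤ ε
  archimedean C@(mkℚ -[1+ c ] e _) ε ε>0 = 0 , λ k _ → begin
    C * (+ 1 / suc k)   ≤⟨ *-monoʳ-≤-nonNeg (+ 1 / suc k) {{nonNegative (0≤/ 1 (suc k))}} (<⇒≤ (negative⁻¹ C)) ⟩
    0ℚ * (+ 1 / suc k)  ≡⟨ *-zeroˡ (+ 1 / suc k) ⟩
    0ℚ                  ≤⟨ <⇒≤ ε>0 ⟩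
    ε                   ∎
    where open ≤-Reasoning
  archimedean C ε@(mkℚ -[1+ a ] d _) ε>0 with () ← positive ε>0
  archimedean C ε@(mkℚ (+ zero) d _) ε>0 with () ← positive ε>0
  archimedean C@(mkℚ (+ c) e _) ε@(mkℚ (+ suc a) d _) ε>0 = c ℕ.* suc d , λ k N≤k → begin
    C * (+ 1 / suc k)                  ≡⟨ cong (_* (+ 1 / suc k)) (↥p/↧p≡p C) ⟨
    (+ c / suc e) * (+ 1 / suc k)      ≡⟨ /-* c (suc e) 1 (suc k) ⟩
    + (c ℕ.* 1) / (suc e ℕ.* suc k)    ≤⟨ /-≤ (c ℕ.* 1) (suc e ℕ.* suc k) (suc a) (suc d) (bound k N≤k) ⟩
    + suc a / suc d                    ≡⟨ ↥p/↧p≡p ε ⟩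
    ε                                  ∎
    where
    open ≤-Reasoning
    bound : ∀ k → c ℕ.* suc d ℕ.≤ k → c ℕ.* 1 ℕ.* suc d ℕ.≤ suc a ℕ.* (suc e ℕ.* suc k)
    bound k h = ℕ.≤-trans (ℕ.≤-reflexive (cong (ℕ._* suc d) (ℕ.*-identityʳ c)))
      (ℕ.≤-trans h (ℕ.≤-trans (ℕ.n≤1+n k)
        (ℕ.≤-trans (ℕ.m≤n*m (suc k) (suc e)) (ℕ.m≤n*m (suc e ℕ.* suc k) (suc a)))))

  0<½* : ∀ {ε} → 0ℚ < ε → 0ℚ < ½ * ε
  0<½* {ε} h = subst (_< ½ * ε) (*-zeroʳ ½) (*-monoʳ-<-pos ½ h)

  halves : ∀ ε → ½ * ε + ½ * ε ≡ ε
  halves = solve 1 (λ ε → con ½ :* ε :+ con ½ :* ε := ε) refl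

∑< : ℕ → (ℕ → ℚ) → ℚ
∑< zero    f = 0ℚ
∑< (suc n) f = ∑< n f + f n

private
  ∑<-≤ : ∀ n {f c} → (∀ i → i ℕ.< n → f i ≤ c) → ∑< n f ≤ (+ n / 1) * c
  ∑<-≤ zero    {c = c} h = ≤-reflexive (sym (*-zeroˡ c))
  ∑<-≤ (suc n) {f} {c} h = begin
    ∑< n f + f n            ≤⟨ +-mono-≤ (∑<-≤ n (λ i i<n → h i (ℕ.m<n⇒m<1+n i<n))) (h n (ℕ.n<1+n n)) ⟩
    (+ n / 1) * c + c       ≡⟨ solve 2 (λ m c → m :* c :+ c := (con 1ℚ :+ m) :* c) refl (+ n / 1) c ⟩
    (1ℚ + (+ n / 1)) * c    ≡⟨ cong (_* c) (suc/1 n) ⟨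
    (+ suc n / 1) * c       ∎
    where open ≤-Reasoning

  ∑<-≥ : ∀ n {f c} → (∀ i → i ℕ.< n → c ≤ f i) → (+ n / 1) * c ≤ ∑< n f
  ∑<-≥ zero    {c = c} h = ≤-reflexive (*-zeroˡ c)
  ∑<-≥ (suc n) {f} {c} h = begin
    (+ suc n / 1) * c       ≡⟨ cong (_* c) (suc/1 n) ⟩
    (1ℚ + (+ n / 1)) * c    ≡⟨ solve 2 (λ m c → (con 1ℚ :+ m) :* c := m :* c :+ c) refl (+ n / 1) c ⟩
    (+ n / 1) * c + c       ≤⟨ +-mono-≤ (∑<-≥ n (λ i i<n → h i (ℕ.m<n⇒m<1+n i<n))) (h n (ℕ.n<1+n n)) ⟩
    ∑< n f + f n            ∎
    where open ≤-Reasoning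

IsCauchy : (ℕ → ℚ) → Set
IsCauchy a = ∀ ε → 0ℚ < ε → ∃ λ N → ∀ i j → N ℕ.≤ i → N ℕ.≤ j → abs (a i - a j) ≤ ε

record ℝ : Set where
  constructor mkℝ
  field
    seq      : ℕ → ℚ
    isCauchy : IsCauchy seq

open ℝ public

infix  4 _≤ᴿ_
infixr 7 _·_

_≤ᴿ_ : Rel ℝ 0ℓ
x ≤ᴿ y = ∀ ε → 0ℚ < ε → ∃ λ N → ∀ k → N ℕ.≤ k → seq x k ≤ seq y k + ε

fromℚ : ℚ → ℝ
fromℚ q = mkℝ (λ _ → q) λ ε ε>0 → 0 , λ _ _ _ _ →
  ≤-trans (≤-reflexive (cong abs (+-inverseʳ q))) (<⇒≤ ε>0)

private
  isCauchy-wlog : ∀ a →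
    (∀ ε → 0ℚ < ε → ∃ λ N → ∀ i j → N ℕ.≤ i → i ℕ.≤ j → abs (a j - a i) ≤ ε) → IsCauchy a
  isCauchy-wlog a h ε ε>0 with N , H ← h ε ε>0 = N , go
    where
    go : ∀ i j → N ℕ.≤ i → N ℕ.≤ j → abs (a i - a j) ≤ ε
    go i j N≤i N≤j with ℕ.≤-total i j
    ... | inj₁ i≤j = ≤-trans (≤-reflexive (∣-∣-sym (a i) (a j))) (H i j N≤i i≤j)
    ... | inj₂ j≤i = H j i N≤j j≤i

  shrink : ∀ a → IsCauchy a → ∀ C → 0ℚ ≤ C → ∀ ε → 0ℚ < ε →
           ∃ λ N → ∀ i j → N ℕ.≤ i → N ℕ.≤ j → C * abs (a i - a j) ≤ ε
  shrink a cau C 0≤C ε ε>0 = proj₁ q , λ i j N≤i N≤j →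
    ≤-trans (*-monoˡ-≤-nonNeg C {{nonNegative 0≤C}} (proj₂ q i j N≤i N≤j)) (proj₂ p d ℕ.≤-refl)
    where
    p = archimedean C ε ε>0
    d = proj₁ p
    q = cau (+ 1 / suc d) (positive⁻¹ (+ 1 / suc d) {{normalize-pos 1 (suc d)}})

_·_ : ℚ → ℝ → ℝ
c · x = mkℝ (λ k → c * seq x k) cau
  where
  cau : IsCauchy (λ k → c * seq x k)
  cau ε ε>0 with N , H ← shrink (seq x) (isCauchy x) (abs c) (0≤∣p∣ c) ε ε>0 = N , λ i j N≤i N≤j → begin
    abs (c * seq x i - c * seq x j)  ≡⟨ cong abs (solve 3 (λ c p q → c :* p :- c :* q := c :* (p :- q)) refl c (seq x i) (seq x j)) ⟩
    abs (c * (seq x i - seq x j))    ≡⟨ ∣p*q∣≡∣p∣*∣q∣ c (seq x i - seq x j) ⟩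
    abs c * abs (seq x i - seq x j)  ≤⟨ H i j N≤i N≤j ⟩
    ε                                ∎
    where open ≤-Reasoning

-- 1/(k+1) + 1/(k+2) + … + 1/(mk) is the right Riemann sum of mesh 1/k for
-- ∫₁ᵐ dt/t, so logSeq m converges to the natural logarithm of m.
logSeq : ℕ → ℕ → ℚ
logSeq m k = ∑< (ℕ.pred m ℕ.* k) λ i → + 1 / suc (k ℕ.+ i)

private
  segment : ℕ → ℕ → ℚ
  segment a r = ∑< r λ i → + 1 / suc (a ℕ.+ i)

  segment-+ : ∀ a r s → segment a (r ℕ.+ s) ≡ segment a r + segment (a ℕ.+ r) s
  segment-+ a r zero rewrite ℕ.+-identityʳ r = sym (+-identityʳ (segment a r))
  segment-+ a r (suc s) rewrite ℕ.+-suc r s = begin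
    segment a (r ℕ.+ s) + + 1 / suc (a ℕ.+ (r ℕ.+ s))
      ≡⟨ cong₂ _+_ (segment-+ a r s) (cong (λ z → + 1 / suc z) (sym (ℕ.+-assoc a r s))) ⟩
    (segment a r + segment (a ℕ.+ r) s) + + 1 / suc (a ℕ.+ r ℕ.+ s)
      ≡⟨ +-assoc (segment a r) _ _ ⟩
    segment a r + segment (a ℕ.+ r) (suc s) ∎
    where open ≡-Reasoning

  module _ (p : ℕ) where
    private m = suc p

    block : ℕ → ℚ
    block k = segment (m ℕ.* k) m

    logSeq-suc : ∀ k → + 1 / suc k + logSeq m (suc k) ≡ logSeq m k + block k
    logSeq-suc k = begin
      + 1 / suc k + segment (suc k) (p ℕ.* suc k)
        ≡⟨ cong₂ _+_ one (cong (λ z → segment z (p ℕ.* suc k)) (ℕ.+-comm 1 k)) ⟩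
      segment k 1 + segment (k ℕ.+ 1) (p ℕ.* suc k)
        ≡⟨ segment-+ k 1 (p ℕ.* suc k) ⟨
      segment k (1 ℕ.+ p ℕ.* suc k)
        ≡⟨ cong (segment k) count ⟩
      segment k (p ℕ.* k ℕ.+ m)
        ≡⟨ segment-+ k (p ℕ.* k) m ⟩
      logSeq m k + block k ∎
      where
      open ≡-Reasoning
      one : + 1 / suc k ≡ 0ℚ + + 1 / suc (k ℕ.+ 0)
      one = trans (cong (λ z → + 1 / suc z) (sym (ℕ.+-identityʳ k))) (sym (+-identityˡ (+ 1 / suc (k ℕ.+ 0))))
      count : 1 ℕ.+ p ℕ.* suc k ≡ p ℕ.* k ℕ.+ suc p
      count = ℕS.solve 2 (λ p k → ℕS.con 1 ℕS.:+ p ℕS.:* (ℕS.con 1 ℕS.:+ k) ℕS.:= p ℕS.:* k ℕS.:+ (ℕS.con 1 ℕS.:+ p)) refl p k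
        where module ℕS = Data.Nat.Solver.+-*-Solver

    block-≥ : ∀ k → + 1 / suc k ≤ block k
    block-≥ k = begin
      + 1 / suc k                          ≡⟨ /-≡ 1 (suc k) (m ℕ.* 1) (1 ℕ.* (m ℕ.* suc k)) arith ⟩
      + (m ℕ.* 1) / (1 ℕ.* (m ℕ.* suc k))  ≡⟨ /-* m 1 1 (m ℕ.* suc k) ⟨
      (+ m / 1) * (+ 1 / (m ℕ.* suc k))    ≤⟨ ∑<-≥ m term ⟩
      block k                              ∎
      where
      open ≤-Reasoning
      arith : 1 ℕ.* (1 ℕ.* (m ℕ.* suc k)) ≡ m ℕ.* 1 ℕ.* suc k
      arith = ℕS.solve 2 (λ m k → ℕS.con 1 ℕS.:* (ℕS.con 1 ℕS.:* (m ℕS.:* k)) ℕS.:= m ℕS.:* ℕS.con 1 ℕS.:* k) refl m (suc k)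
        where module ℕS = Data.Nat.Solver.+-*-Solver
      term : ∀ i → i ℕ.< m → + 1 / (m ℕ.* suc k) ≤ + 1 / suc (m ℕ.* k ℕ.+ i)
      term i i<m = /-≤ 1 (m ℕ.* suc k) 1 (suc (m ℕ.* k ℕ.+ i)) (ℕ.*-monoʳ-≤ 1 le)
        where
        le : suc (m ℕ.* k ℕ.+ i) ℕ.≤ m ℕ.* suc k
        le = ℕ.≤-trans (ℕ.≤-reflexive (sym (ℕ.+-suc (m ℕ.* k) i)))
               (ℕ.≤-trans (ℕ.+-monoʳ-≤ (m ℕ.* k) i<m)
                 (ℕ.≤-reflexive (trans (ℕ.+-comm (m ℕ.* k) m) (sym (ℕ.*-suc m k)))))

    block-≤ : ∀ k → block (suc k) ≤ + 1 / suc k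
    block-≤ k = begin
      block (suc k)                        ≤⟨ ∑<-≤ m term ⟩
      (+ m / 1) * (+ 1 / (m ℕ.* suc k))    ≡⟨ /-* m 1 1 (m ℕ.* suc k) ⟩
      + (m ℕ.* 1) / (1 ℕ.* (m ℕ.* suc k))  ≡⟨ /-≡ 1 (suc k) (m ℕ.* 1) (1 ℕ.* (m ℕ.* suc k)) arith ⟨
      + 1 / suc k                          ∎
      where
      open ≤-Reasoning
      arith : 1 ℕ.* (1 ℕ.* (m ℕ.* suc k)) ≡ m ℕ.* 1 ℕ.* suc k
      arith = ℕS.solve 2 (λ m k → ℕS.con 1 ℕS.:* (ℕS.con 1 ℕS.:* (m ℕS.:* k)) ℕS.:= m ℕS.:* ℕS.con 1 ℕS.:* k) refl m (suc k)
        where module ℕS = Data.Nat.Solver.+-*-Solver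
      term : ∀ i → i ℕ.< m → + 1 / suc (m ℕ.* suc k ℕ.+ i) ≤ + 1 / (m ℕ.* suc k)
      term i _ = /-≤ 1 (suc (m ℕ.* suc k ℕ.+ i)) 1 (m ℕ.* suc k)
        (ℕ.*-monoʳ-≤ 1 (ℕ.m≤n⇒m≤1+n (ℕ.m≤m+n (m ℕ.* suc k) i)))

    logSeq-mono : ∀ k d → logSeq m k ≤ logSeq m (d ℕ.+ k)
    logSeq-mono k zero    = ≤-refl
    logSeq-mono k (suc d) = ≤-trans (logSeq-mono k d) (begin
      logSeq m k′                                    ≡⟨ solve 2 (λ l u → l := l :+ u :- u) refl (logSeq m k′) u ⟩
      logSeq m k′ + u - u                            ≤⟨ +-monoˡ-≤ (- u) (+-monoʳ-≤ (logSeq m k′) (block-≥ k′)) ⟩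
      logSeq m k′ + block k′ - u                     ≡⟨ cong (_- u) (logSeq-suc k′) ⟨
      u + logSeq m (suc k′) - u                      ≡⟨ solve 2 (λ l u → u :+ l :- u := l) refl (logSeq m (suc k′)) u ⟩
      logSeq m (suc k′)                              ∎)
      where
      open ≤-Reasoning
      k′ = d ℕ.+ k
      u = + 1 / suc k′

    logSeq-bound : ∀ k d → + 1 / suc (d ℕ.+ k) + logSeq m (suc (d ℕ.+ k)) ≤ + 1 / suc k + logSeq m (suc k)
    logSeq-bound k zero    = ≤-refl
    logSeq-bound k (suc d) = ≤-trans (begin
      + 1 / suc (suc k′) + logSeq m (suc (suc k′))  ≡⟨ logSeq-suc (suc k′) ⟩
      logSeq m (suc k′) + block (suc k′)            ≤⟨ +-monoʳ-≤ (logSeq m (suc k′)) (block-≤ k′) ⟩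
      logSeq m (suc k′) + + 1 / suc k′              ≡⟨ +-comm (logSeq m (suc k′)) (+ 1 / suc k′) ⟩
      + 1 / suc k′ + logSeq m (suc k′)              ∎) (logSeq-bound k d)
      where
      open ≤-Reasoning
      k′ = d ℕ.+ k

    logSeq-cauchy : IsCauchy (logSeq m)
    logSeq-cauchy = isCauchy-wlog (logSeq m) go
      where
      open ≤-Reasoning
      go : ∀ ε → 0ℚ < ε → ∃ λ N → ∀ i j → N ℕ.≤ i → i ℕ.≤ j → abs (logSeq m j - logSeq m i) ≤ ε
      go ε ε>0 with N , H ← archimedean 1ℚ ε ε>0 = suc N , step
        where
        step : ∀ i j → suc N ℕ.≤ i → i ℕ.≤ j → abs (logSeq m j - logSeq m i) ≤ ε
        step (suc i) (suc j) (ℕ.s≤s N≤i) (ℕ.s≤s i≤j) =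
          subst (λ z → abs (logSeq m (suc z) - l) ≤ ε) (ℕ.m∸n+n≡m i≤j) (begin
            abs (l′ - l)                  ≡⟨ 0≤p⇒∣p∣≡p (≤-trans (≤-reflexive (sym (+-inverseʳ l))) (+-monoˡ-≤ (- l) l≤l′)) ⟩
            l′ - l                        ≤⟨ +-monoˡ-≤ (- l) (p≤q+p l′ (0≤/ 1 (suc (d ℕ.+ i)))) ⟩
            + 1 / suc (d ℕ.+ i) + l′ - l  ≤⟨ +-monoˡ-≤ (- l) (logSeq-bound i d) ⟩
            + 1 / suc i + l - l           ≡⟨ solve 2 (λ u l → u :+ l :- l := con 1ℚ :* u) refl (+ 1 / suc i) l ⟩
            1ℚ * (+ 1 / suc i)            ≤⟨ H i N≤i ⟩
            ε                             ∎)
          where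
          d = j ℕ.∸ i
          l = logSeq m (suc i)
          l′ = logSeq m (suc (d ℕ.+ i))
          l≤l′ : l ≤ l′
          l≤l′ = subst (λ z → l ≤ logSeq m z) (ℕ.+-suc d i) (logSeq-mono (suc i) d)

log : (m : ℕ) .{{_ : ℕ.NonZero m}} → ℝ
log m@(suc p) = mkℝ (logSeq m) (logSeq-cauchy p)

expTerm : ℚ → ℕ → ℚ
expTerm x j = x ^ j * (+ 1 / j !) {{j ℕ.!≢0}}

expSum : ℕ → ℚ → ℚ
expSum k x = ∑< k (expTerm x)

private
  1/! : ℕ → ℚ
  1/! j = (+ 1 / j !) {{j ℕ.!≢0}}

  0≤1/! : ∀ j → 0ℚ ≤ 1/! j
  0≤1/! j = 0≤/ 1 (j !) {{j ℕ.!≢0}}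

  1/!-suc : ∀ j → (+ suc j / 1) * 1/! (suc j) ≡ 1/! j
  1/!-suc j = trans (/-* (suc j) 1 1 (suc j !))
    (/-≡ (suc j ℕ.* 1) (1 ℕ.* suc j !) 1 (j !) (arith (suc j) (j !)))
    where
    instance
      _ = j ℕ.!≢0
      _ = suc j ℕ.!≢0
      _ = ℕ.m*n≢0 1 (suc j !)
    arith : ∀ s f → s ℕ.* 1 ℕ.* f ≡ 1 ℕ.* (1 ℕ.* (s ℕ.* f))
    arith = ℕS.solve 2 (λ s f → s ℕS.:* ℕS.con 1 ℕS.:* f ℕS.:= ℕS.con 1 ℕS.:* (ℕS.con 1 ℕS.:* (s ℕS.:* f))) refl
      where module ℕS = Data.Nat.Solver.+-*-Solver

  1/!-suc′ : ∀ j → 1/! (suc j) ≡ (+ 1 / suc j) * 1/! j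
  1/!-suc′ j = begin
    1/! (suc j)                                         ≡⟨ *-identityˡ _ ⟨
    1ℚ * 1/! (suc j)                                    ≡⟨ cong (_* 1/! (suc j)) unit ⟨
    ((+ 1 / suc j) * (+ suc j / 1)) * 1/! (suc j)       ≡⟨ *-assoc (+ 1 / suc j) _ _ ⟩
    (+ 1 / suc j) * ((+ suc j / 1) * 1/! (suc j))       ≡⟨ cong ((+ 1 / suc j) *_) (1/!-suc j) ⟩
    (+ 1 / suc j) * 1/! j                               ∎
    where
    open ≡-Reasoning
    unit : (+ 1 / suc j) * (+ suc j / 1) ≡ 1ℚ
    unit = trans (/-* 1 (suc j) (suc j) 1)
      (/-≡ (1 ℕ.* suc j) (suc j ℕ.* 1) 1 1 (ℕ.*-assoc 1 (suc j) 1))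

  module ExpBounds (B : ℚ) (0≤B : 0ℚ ≤ B) where
    0≤B^ : ∀ j → 0ℚ ≤ B ^ j
    0≤B^ zero    = 0≤/ 1 1
    0≤B^ (suc j) = 0≤* 0≤B (0≤B^ j)

    b : ℕ → ℚ
    b = expTerm B

    0≤b : ∀ j → 0ℚ ≤ b j
    0≤b j = 0≤* (0≤B^ j) (0≤1/! j)

    0≤sum : ∀ k → 0ℚ ≤ expSum k B
    0≤sum zero    = ≤-refl
    0≤sum (suc k) = 0≤+ (0≤sum k) (0≤b k)

    b-suc : ∀ j → b (suc j) ≡ B * b j * (+ 1 / suc j)
    b-suc j = trans (cong (B * B ^ j *_) (1/!-suc′ j))
      (solve 4 (λ B p i f → B :* p :* (i :* f) := B :* (p :* f) :* i) refl B (B ^ j) (+ 1 / suc j) (1/! j))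

    ∣^∣≤ : ∀ {y} → abs y ≤ B → ∀ j → abs (y ^ j) ≤ B ^ j
    ∣^∣≤ h zero = ≤-refl
    ∣^∣≤ {y} h (suc j) = ≤-trans (≤-reflexive (∣p*q∣≡∣p∣*∣q∣ y (y ^ j)))
      (*-mono 0≤B (0≤∣p∣ (y ^ j)) h (∣^∣≤ h j))

    ∣term∣≤ : ∀ {y} → abs y ≤ B → ∀ j → abs (expTerm y j) ≤ b j
    ∣term∣≤ {y} h j = begin
      abs (y ^ j * 1/! j)        ≡⟨ ∣p*q∣≡∣p∣*∣q∣ (y ^ j) (1/! j) ⟩
      abs (y ^ j) * abs (1/! j)  ≡⟨ cong (abs (y ^ j) *_) (0≤p⇒∣p∣≡p (0≤1/! j)) ⟩
      abs (y ^ j) * 1/! j        ≤⟨ *-monoʳ-≤-nonNeg (1/! j) {{nonNegative (0≤1/! j)}} (∣^∣≤ h j) ⟩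
      B ^ j * 1/! j              ∎
      where open ≤-Reasoning

    tail : ∀ {y} → abs y ≤ B → ∀ k d → abs (expSum (d ℕ.+ k) y - expSum k y) ≤ expSum (d ℕ.+ k) B - expSum k B
    tail {y} h k zero = ≤-reflexive (trans (cong abs (+-inverseʳ (expSum k y))) (sym (+-inverseʳ (expSum k B))))
    tail {y} h k (suc d) = begin
      abs (s + t - s₀)        ≡⟨ cong abs (solve 3 (λ s t s₀ → s :+ t :- s₀ := s :- s₀ :+ t) refl s t s₀) ⟩
      abs (s - s₀ + t)        ≤⟨ ∣p+q∣≤∣p∣+∣q∣ (s - s₀) t ⟩
      abs (s - s₀) + abs t    ≤⟨ +-mono-≤ (tail h k d) (∣term∣≤ h (d ℕ.+ k)) ⟩
      (S - S₀) + b (d ℕ.+ k)  ≡⟨ solve 3 (λ s t s₀ → s :- s₀ :+ t := s :+ t :- s₀) refl S (b (d ℕ.+ k)) S₀ ⟩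
      S + b (d ℕ.+ k) - S₀    ∎
      where
      open ≤-Reasoning
      s = expSum (d ℕ.+ k) y
      s₀ = expSum k y
      t = expTerm y (d ℕ.+ k)
      S = expSum (d ℕ.+ k) B
      S₀ = expSum k B

    ^-lipschitz : ∀ {y z} → abs y ≤ B → abs z ≤ B → ∀ j →
                  abs (y ^ suc j - z ^ suc j) ≤ (+ suc j / 1) * B ^ j * abs (y - z)
    ^-lipschitz {y} {z} hy hz zero = ≤-reflexive (trans
      (cong abs (solve 2 (λ y z → y :* con 1ℚ :- z :* con 1ℚ := y :- z) refl y z))
      (solve 1 (λ w → w := con 1ℚ :* con 1ℚ :* w) refl (abs (y - z))))
    ^-lipschitz {y} {z} hy hz (suc j) = begin
      abs (y * Y - z * Z)                    ≡⟨ cong abs (solve 4 (λ y Y z Z → y :* Y :- z :* Z := y :* (Y :- Z) :+ Z :* (y :- z)) refl y Y z Z) ⟩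
      abs (y * (Y - Z) + Z * (y - z))        ≤⟨ ∣p+q∣≤∣p∣+∣q∣ (y * (Y - Z)) (Z * (y - z)) ⟩
      abs (y * (Y - Z)) + abs (Z * (y - z))  ≡⟨ cong₂ _+_ (∣p*q∣≡∣p∣*∣q∣ y (Y - Z)) (∣p*q∣≡∣p∣*∣q∣ Z (y - z)) ⟩
      abs y * abs (Y - Z) + abs Z * w        ≤⟨ +-mono-≤ (*-mono 0≤B (0≤∣p∣ (Y - Z)) hy (^-lipschitz hy hz j))
                                                       (*-monoʳ-≤-nonNeg w {{nonNegative (0≤∣p∣ (y - z))}} (∣^∣≤ hz (suc j))) ⟩
      B * (n * B ^ j * w) + B * B ^ j * w   ≡⟨ solve 4 (λ B n p w → B :* (n :* p :* w) :+ B :* p :* w := (con 1ℚ :+ n) :* (B :* p) :* w) refl B n (B ^ j) w ⟩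
      (1ℚ + n) * (B * B ^ j) * w            ≡⟨ cong (λ c → c * (B * B ^ j) * w) (suc/1 (suc j)) ⟨
      (+ suc (suc j) / 1) * (B * B ^ j) * w ∎
      where
      open ≤-Reasoning
      Y = y ^ suc j
      Z = z ^ suc j
      w = abs (y - z)
      n = + suc j / 1

    term-lipschitz : ∀ {y z} → abs y ≤ B → abs z ≤ B → ∀ j →
                     abs (expTerm y (suc j) - expTerm z (suc j)) ≤ b j * abs (y - z)
    term-lipschitz {y} {z} hy hz j = begin
      abs (Y * f - Z * f)  ≡⟨ cong abs (solve 3 (λ Y Z f → Y :* f :- Z :* f := (Y :- Z) :* f) refl Y Z f) ⟩
      abs ((Y - Z) * f)    ≡⟨ ∣p*q∣≡∣p∣*∣q∣ (Y - Z) f ⟩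
      abs (Y - Z) * abs f  ≡⟨ cong (abs (Y - Z) *_) (0≤p⇒∣p∣≡p (0≤1/! (suc j))) ⟩
      abs (Y - Z) * f      ≤⟨ *-monoʳ-≤-nonNeg f {{nonNegative (0≤1/! (suc j))}} (^-lipschitz hy hz j) ⟩
      n * B ^ j * w * f    ≡⟨ solve 4 (λ n p w f → n :* p :* w :* f := p :* (n :* f) :* w) refl n (B ^ j) w f ⟩
      B ^ j * (n * f) * w  ≡⟨ cong (λ c → B ^ j * c * w) (1/!-suc j) ⟩
      b j * w              ∎
      where
      open ≤-Reasoning
      Y = y ^ suc j
      Z = z ^ suc j
      w = abs (y - z)
      n = + suc j / 1
      f = 1/! (suc j)

    sum-lipschitz : ∀ {y z} → abs y ≤ B → abs z ≤ B → ∀ k →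
                    abs (expSum (suc k) y - expSum (suc k) z) ≤ expSum k B * abs (y - z)
    sum-lipschitz {y} {z} hy hz zero = ≤-reflexive (sym (*-zeroˡ (abs (y - z))))
    sum-lipschitz {y} {z} hy hz (suc k) = begin
      abs ((s + u) - (t + v))    ≡⟨ cong abs (solve 4 (λ s t u v → (s :+ u) :- (t :+ v) := (s :- t) :+ (u :- v)) refl s t u v) ⟩
      abs ((s - t) + (u - v))    ≤⟨ ∣p+q∣≤∣p∣+∣q∣ (s - t) (u - v) ⟩
      abs (s - t) + abs (u - v)  ≤⟨ +-mono-≤ (sum-lipschitz hy hz k) (term-lipschitz hy hz k) ⟩
      expSum k B * w + b k * w   ≡⟨ *-distribʳ-+ w (expSum k B) (b k) ⟨
      expSum (suc k) B * w       ∎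
      where
      open ≤-Reasoning
      s = expSum (suc k) y
      t = expSum (suc k) z
      u = expTerm y (suc k)
      v = expTerm z (suc k)
      w = abs (y - z)

    2ℚ = 1ℚ + 1ℚ

    module _ (N : ℕ) (small : ∀ k → N ℕ.≤ k → 2ℚ * B * (+ 1 / suc k) ≤ 1ℚ) where

      majorant : ℕ → ℚ
      majorant k = expSum k B + 2ℚ * b k

      b-halves : ∀ k → N ℕ.≤ k → 2ℚ * b (suc k) ≤ b k
      b-halves k N≤k = begin
        2ℚ * b (suc k)                   ≡⟨ cong (2ℚ *_) (b-suc k) ⟩
        2ℚ * (B * b k * i)               ≡⟨ solve 4 (λ t B c i → t :* (B :* c :* i) := t :* B :* i :* c) refl 2ℚ B (b k) i ⟩
        2ℚ * B * i * b k                 ≤⟨ *-monoʳ-≤-nonNeg (b k) {{nonNegative (0≤b k)}} (small k N≤k) ⟩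
        1ℚ * b k                         ≡⟨ *-identityˡ (b k) ⟩
        b k                              ∎
        where
        open ≤-Reasoning
        i = + 1 / suc k

      majorant-anti : ∀ k → N ℕ.≤ k → ∀ d → majorant (d ℕ.+ k) ≤ majorant k
      majorant-anti k N≤k zero    = ≤-refl
      majorant-anti k N≤k (suc d) = ≤-trans (begin
        S + c + 2ℚ * b (suc k′)   ≤⟨ +-monoʳ-≤ (S + c) (b-halves k′ (ℕ.≤-trans N≤k (ℕ.m≤n+m k d))) ⟩
        S + c + c                 ≡⟨ solve 2 (λ S c → S :+ c :+ c := S :+ (con 1ℚ :+ con 1ℚ) :* c) refl S c ⟩
        S + 2ℚ * c                ∎) (majorant-anti k N≤k d)
        where
        open ≤-Reasoning
        k′ = d ℕ.+ k
        S = expSum k′ B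
        c = b k′

      M : ℚ
      M = majorant N

      majorant≤M : ∀ k → N ℕ.≤ k → majorant k ≤ M
      majorant≤M k N≤k = subst (λ z → majorant z ≤ M) (ℕ.m∸n+n≡m N≤k) (majorant-anti N ℕ.≤-refl (k ℕ.∸ N))

      sum≤M : ∀ k → N ℕ.≤ k → expSum k B ≤ M
      sum≤M k N≤k = ≤-trans (p≤p+q (expSum k B) (0≤* (0≤/ 2 1) (0≤b k))) (majorant≤M k N≤k)

      2b≤M : ∀ k → N ℕ.≤ k → 2ℚ * b k ≤ M
      2b≤M k N≤k = ≤-trans (p≤q+p (2ℚ * b k) (0≤sum k)) (majorant≤M k N≤k)

      0≤M : 0ℚ ≤ M
      0≤M = ≤-trans (0≤sum N) (sum≤M N ℕ.≤-refl)

      tail≤ : ∀ {y} → abs y ≤ B → ∀ k d → N ℕ.≤ k →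
              abs (expSum (d ℕ.+ suc k) y - expSum (suc k) y) ≤ B * M * (+ 1 / suc k)
      tail≤ {y} h k d N≤k = begin
        abs (expSum l y - expSum (suc k) y)  ≤⟨ tail h (suc k) d ⟩
        expSum l B - S                       ≤⟨ +-monoˡ-≤ (- S) (p≤p+q (expSum l B) (0≤* (0≤/ 2 1) (0≤b l))) ⟩
        majorant l - S                       ≤⟨ +-monoˡ-≤ (- S) (majorant-anti (suc k) (ℕ.m≤n⇒m≤1+n N≤k) d) ⟩
        majorant (suc k) - S                 ≡⟨ solve 2 (λ S c → S :+ c :- S := c) refl S (2ℚ * b (suc k)) ⟩
        2ℚ * b (suc k)                       ≡⟨ cong (2ℚ *_) (b-suc k) ⟩
        2ℚ * (B * b k * i)                   ≡⟨ solve 4 (λ t B c i → t :* (B :* c :* i) := B :* (t :* c) :* i) refl 2ℚ B (b k) i ⟩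
        B * (2ℚ * b k) * i                   ≤⟨ *-monoʳ-≤-nonNeg i {{nonNegative (0≤/ 1 (suc k))}}
                                                            (*-monoˡ-≤-nonNeg B {{nonNegative 0≤B}} (2b≤M k N≤k)) ⟩
        B * M * i                                      ∎
        where
        open ≤-Reasoning
        l = d ℕ.+ suc k
        S = expSum (suc k) B
        i = + 1 / suc k

      cauchy : ∀ a → IsCauchy a → (N₀ : ℕ) → (∀ k → N₀ ℕ.≤ k → abs (a k) ≤ B) →
               IsCauchy (λ k → expSum k (a k))
      cauchy a cau N₀ bounded = isCauchy-wlog (λ k → expSum k (a k)) go
        where
        go : ∀ ε → 0ℚ < ε → ∃ λ K → ∀ i j → K ℕ.≤ i → i ℕ.≤ j → abs (expSum j (a j) - expSum i (a i)) ≤ ε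
        go ε ε>0 = suc K , step
          where
          p₁ = archimedean (B * M) (½ * ε) (0<½* ε>0)
          p₂ = shrink a cau M 0≤M (½ * ε) (0<½* ε>0)
          N₁ = proj₁ p₁
          N₂ = proj₁ p₂
          K = N ℕ.⊔ N₀ ℕ.⊔ (N₁ ℕ.⊔ N₂)
          N≤K : N ℕ.≤ K
          N≤K = ℕ.≤-trans (ℕ.m≤m⊔n N N₀) (ℕ.m≤m⊔n (N ℕ.⊔ N₀) (N₁ ℕ.⊔ N₂))
          N₀≤K : N₀ ℕ.≤ K
          N₀≤K = ℕ.≤-trans (ℕ.m≤n⊔m N N₀) (ℕ.m≤m⊔n (N ℕ.⊔ N₀) (N₁ ℕ.⊔ N₂))
          N₁≤K : N₁ ℕ.≤ K
          N₁≤K = ℕ.≤-trans (ℕ.m≤m⊔n N₁ N₂) (ℕ.m≤n⊔m (N ℕ.⊔ N₀) (N₁ ℕ.⊔ N₂))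
          N₂≤K : N₂ ℕ.≤ K
          N₂≤K = ℕ.≤-trans (ℕ.m≤n⊔m N₁ N₂) (ℕ.m≤n⊔m (N ℕ.⊔ N₀) (N₁ ℕ.⊔ N₂))
          step : ∀ i j → suc K ℕ.≤ i → i ℕ.≤ j → abs (expSum j (a j) - expSum i (a i)) ≤ ε
          step i@(suc i′) j (ℕ.s≤s K≤i′) i≤j = begin
            abs (p - r)                ≡⟨ cong abs (solve 3 (λ p q r → p :- r := (p :- q) :+ (q :- r)) refl p q r) ⟩
            abs ((p - q) + (q - r))    ≤⟨ ∣p+q∣≤∣p∣+∣q∣ (p - q) (q - r) ⟩
            abs (p - q) + abs (q - r)  ≤⟨ +-mono-≤ part₁ part₂ ⟩
            ½ * ε + ½ * ε              ≡⟨ halves ε ⟩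
            ε                          ∎
            where
            open ≤-Reasoning
            p = expSum j (a j)
            q = expSum i (a j)
            r = expSum i (a i)
            K≤i : K ℕ.≤ i
            K≤i = ℕ.m≤n⇒m≤1+n K≤i′
            K≤j : K ℕ.≤ j
            K≤j = ℕ.≤-trans K≤i i≤j
            bi = bounded i (ℕ.≤-trans N₀≤K K≤i)
            bj = bounded j (ℕ.≤-trans N₀≤K K≤j)
            part₁ : abs (p - q) ≤ ½ * ε
            part₁ = ≤-trans
              (subst (λ z → abs (expSum z (a j) - q) ≤ B * M * (+ 1 / suc i′)) (ℕ.m∸n+n≡m i≤j)
                (tail≤ bj i′ (j ℕ.∸ i) (ℕ.≤-trans N≤K K≤i′)))
              (proj₂ p₁ i′ (ℕ.≤-trans N₁≤K K≤i′))
            part₂ : abs (q - r) ≤ ½ * ε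
            part₂ = ≤-trans (sum-lipschitz bj bi i′)
              (≤-trans (*-monoʳ-≤-nonNeg (abs (a j - a i)) {{nonNegative (0≤∣p∣ (a j - a i))}} (sum≤M i′ (ℕ.≤-trans N≤K K≤i′)))
                (proj₂ p₂ j i (ℕ.≤-trans N₂≤K K≤j) (ℕ.≤-trans N₂≤K K≤i)))

  exp-cauchy : ∀ a → IsCauchy a → IsCauchy (λ k → expSum k (a k))
  exp-cauchy a cau =
    ExpBounds.cauchy (1ℚ + abs (a N₀)) (0≤+ (0≤/ 1 1) (0≤∣p∣ (a N₀))) (proj₁ p) (proj₂ p) a cau N₀ bounded
    where
    N₀ = proj₁ (cau 1ℚ (positive⁻¹ 1ℚ))
    H = proj₂ (cau 1ℚ (positive⁻¹ 1ℚ))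
    p = archimedean ((1ℚ + 1ℚ) * (1ℚ + abs (a N₀))) 1ℚ (positive⁻¹ 1ℚ)
    bounded : ∀ k → N₀ ℕ.≤ k → abs (a k) ≤ 1ℚ + abs (a N₀)
    bounded k h = begin
      abs (a k)                      ≡⟨ cong abs (solve 2 (λ p q → p := (p :- q) :+ q) refl (a k) (a N₀)) ⟩
      abs ((a k - a N₀) + a N₀)      ≤⟨ ∣p+q∣≤∣p∣+∣q∣ (a k - a N₀) (a N₀) ⟩
      abs (a k - a N₀) + abs (a N₀)  ≤⟨ +-monoˡ-≤ (abs (a N₀)) (H k N₀ h ℕ.≤-refl) ⟩
      1ℚ + abs (a N₀)                ∎
      where open ≤-Reasoning

-- A diagonal sequence: the k-term partial sum of Σ xʲ/j! is taken at the k-th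
-- rational approximation of x.
exp : ℝ → ℝ
exp x = mkℝ (λ k → expSum k (seq x k)) (exp-cauchy (seq x) (isCauchy x))

record Graph (n : ℕ) : Set₁ where
  field
    Adj        : Rel (Fin n) 0ℓ
    adj?       : Decidable Adj
    Adj-sym    : Symmetric Adj
    Adj-irrefl : Irreflexive _≡_ Adj

open Graph public

module _ {n : ℕ} (G : Graph n) where

  degree : Fin n → ℕ
  degree v = length (filter (adj? G v) (allFin n))

  Regular : ℕ → Set
  Regular Δ = ∀ v → degree v ≡ Δ

  -- The graph with no vertices does not count as connected.
  Connected : Set
  Connected = Fin n × (∀ u v → Star (Adj G) u v)

  module _ {k : ℕ} where

    Proper : Pred (Fin n → Fin k) 0ℓ
    Proper α = ∀ x y → Adj G x y → α x ≢ α y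

    Frozen : Pred (Fin n → Fin k) 0ℓ
    Frozen α = ∀ v (c : Fin k) → ∃ λ u → (u ≡ v ⊎ Adj G v u) × α u ≡ c

    proper? : Unary.Decidable Proper
    proper? α = Fin.all? λ x → Fin.all? λ y → adj? G x y →-dec ¬? (α x Fin.≟ α y)

    frozen? : Unary.Decidable Frozen
    frozen? α = Fin.all? λ v → Fin.all? λ c → Fin.any? λ u →
      (u Fin.≟ v ⊎-dec adj? G v u) ×-dec α u Fin.≟ c

  -- finToFun is a bijection from Fin (k ^ n) to the functions Fin n → Fin k
  -- (up to pointwise equality), so each proper colouring is listed exactly once.
  Ω : (k : ℕ) → List (Fin n → Fin k)
  Ω k = filter proper? (map finToFun (allFin (k ℕ.^ n)))

-- Probability of P under the uniform distribution on the entries of a list.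
-- The value 0 for the empty list is a convention.
Pr : {A : Set} {P : Pred A 0ℓ} → Unary.Decidable P → List A → ℚ
Pr P? []         = 0ℚ
Pr P? xs@(_ ∷ _) = + length (filter P? xs) / length xs

{-# OPTIONS --safe #-}

-- Take m copies of K_{Δ+1} minus an edge and join them in a ring, so that
-- n = m (Δ + 1).  Colouring the two ends of the missing edge in the same way in
-- every copy and permuting the other Δ - 1 colours inside each copy gives frozen
-- colourings.
-- An arbitrary proper colouring differs from one of these, in each copy, by one
-- of at most 2 Δ (Δ + 1) recolourings, so at least a (2 Δ (Δ + 1))^{-m} fraction
-- of all proper colourings is frozen.  As 2 (Δ + 1) < Δ² for Δ ≥ 3, this exceeds
-- Δ^{-3m} ≥ Δ^{-3n/Δ}.
-- On the analytic side, the partial sums E_k of exp satisfy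
-- E_k(-x) E_l(x) ≤ 1 + o(1) for l ≥ k, and E_l(3 m L_k) ≥ ((Δk+1)/(k+1))^{3m} for
-- the k-th Riemann sum L_k of log Δ, because exp (1/j) ≥ (j+1)/j telescopes.
module Submission where

open import Defs
open import Level using (0ℓ)
open import Data.Nat.Base as ℕ using (ℕ; zero; suc; _!)
import Data.Nat.Properties as ℕ
import Data.Nat.Solver
open import Data.Integer.Base using (+_)
open import Data.Fin.Base using (Fin; zero; suc; toℕ; fromℕ; inject₁; punchIn; punchOut; lift; combine; remQuot; finToFun; funToFin)
import Data.Fin.Properties as Fin
open import Data.Fin.Relation.Unary.Top using (view; ‵fromℕ; ‵inject₁; view-fromℕ; view-inject₁)
open import Data.List.Base using (List; []; _∷_; _++_; length; filter; map; allFin; cartesianProductWith)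
open import Data.List.Properties using (length-map; length-++; length-++-sucʳ; length-tabulate)
open import Data.List.Membership.Propositional using (_∈_)
open import Data.List.Membership.Propositional.Properties
open import Data.List.Relation.Unary.Any using (here; there)
import Data.List.Relation.Unary.All as All
open import Data.List.Relation.Unary.AllPairs using (_∷_)
open import Data.List.Relation.Unary.Unique.Propositional using (Unique)
import Data.List.Relation.Unary.Unique.Propositional.Properties as Unique
open import Data.Product using (Σ; ∃; ∃₂; _×_; _,_; proj₁; proj₂; map₂)
open import Data.Sum.Base using (_⊎_; inj₁; inj₂)
open import Function.Base using (_∘_; id)
open import Function.Definitions using (Injective)
open import Relation.Binary.Construct.Closure.ReflexiveTransitive as Star using (Star; _◅_; _◅◅_; reverse)
open import Relation.Binary.PropositionalEquality
open import Relation.Nullary using (yes; no; contradiction; ¬?; _×-dec_)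
open import Relation.Unary as Unary using (Pred)

module ℕS = Data.Nat.Solver.+-*-Solver

-- The number of `Code`s of one block, bracketed like the nested products that `combine` enumerates.
cost : ℕ → ℕ
cost Δ = suc Δ ℕ.* (Δ ℕ.* 2)

-- Counting in lists and maps between finite sets

Unique-⊆⇒length-≤ : ∀ {a} {A : Set a} {xs ys : List A} →
  Unique xs → (∀ {x} → x ∈ xs → x ∈ ys) → length xs ℕ.≤ length ys
Unique-⊆⇒length-≤ {xs = []} u h = ℕ.z≤n
Unique-⊆⇒length-≤ {xs = x ∷ xs} (x∉ ∷ u) h with as , bs , refl ← ∈-∃++ (h (here refl)) =
  subst (suc (length xs) ℕ.≤_) (sym (length-++-sucʳ as x bs)) (ℕ.s≤s (Unique-⊆⇒length-≤ u rest))
  where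
  rest : ∀ {z} → z ∈ xs → z ∈ as ++ bs
  rest z∈ with ∈-++⁻ as (h (there z∈))
  ... | inj₁ z∈as         = ∈-++⁺ˡ z∈as
  ... | inj₂ (here refl)  = contradiction refl (All.lookup x∉ z∈)
  ... | inj₂ (there z∈bs) = ∈-++⁺ʳ as z∈bs

length-cartesianProductWith : ∀ {a b c} {A : Set a} {B : Set b} {C : Set c} (f : A → B → C) xs ys →
  length (cartesianProductWith f xs ys) ≡ length xs ℕ.* length ys
length-cartesianProductWith f []       ys = refl
length-cartesianProductWith f (x ∷ xs) ys = trans (length-++ (map (f x) ys))
  (cong₂ ℕ._+_ (length-map (f x) ys) (length-cartesianProductWith f xs ys))

funToFin-cong : ∀ {m n} {f g : Fin m → Fin n} → f ≗ g → funToFin f ≡ funToFin g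
funToFin-cong {zero}  h = refl
funToFin-cong {suc m} h = cong₂ combine (h zero) (funToFin-cong (h ∘ suc))

finToFun-injective : ∀ {m n} {x y : Fin (m ℕ.^ n)} → finToFun {m} {n} x ≡ finToFun y → x ≡ y
finToFun-injective {m} {n} {x} {y} e =
  trans (sym (Fin.funToFin-finToFin {n} {m} x)) (trans (cong funToFin e) (Fin.funToFin-finToFin {n} {m} y))

-- A surjection would have a section, which is an injection of `Fin (suc m)` into `Fin m`.
missed : ∀ {m} (f : Fin m → Fin (suc m)) → ∃ λ y → ∀ x → f x ≢ y
missed {m} f with y , y∉ ← Fin.¬∀⟶∃¬ (suc m) (λ y → ∃ λ x → f x ≡ y) (λ y → Fin.any? λ x → f x Fin.≟ y)
    (λ surj → Fin.<⇒notInjective (ℕ.n<1+n m) (λ {y} {z} e → trans (sym (proj₂ (surj y))) (trans (cong f e) (proj₂ (surj z)))))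
  = y , λ x e → y∉ (x , e)

-- If `y` were missed, `punchOut` at `y` would turn `f` into an injection into a smaller set.
injective⇒surjective : ∀ {m} {f : Fin m → Fin m} → Injective _≡_ _≡_ f → ∀ y → ∃ λ x → f x ≡ y
injective⇒surjective {suc m} {f} inj y with Fin.any? (λ x → f x Fin.≟ y)
... | yes found = found
... | no  y∉    = contradiction (λ {x} {z} e → inj (Fin.punchOut-injective (avoid x) (avoid z) e))
                                (Fin.<⇒notInjective (ℕ.n<1+n m))
  where
  avoid : ∀ x → y ≢ f x
  avoid x e = y∉ (x , sym e)

-- The necklace graph: regularity and connectedness

module _ {p : ℕ} where

  next prev : Fin (suc p) → Fin (suc p)
  next i with view i
  ... | ‵fromℕ     = zero
  ... | ‵inject₁ j = suc j
  prev zero    = fromℕ p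
  prev (suc j) = inject₁ j

  next-prev : ∀ i → next (prev i) ≡ i
  next-prev zero    rewrite view-fromℕ p   = refl
  next-prev (suc j) rewrite view-inject₁ j = refl

  prev-next : ∀ i → prev (next i) ≡ i
  prev-next i with view i
  ... | ‵fromℕ     = refl
  ... | ‵inject₁ j = refl

-- A cyclic lift of K_{3+e}: p + 1 copies of the complete graph minus the edge
-- {0 , 1}, where vertex 1 of each copy is joined to vertex 0 of the next one.
module Necklace (p e : ℕ) where

  Block Position : Set
  Block    = Fin (suc p)
  Position = Fin (3 ℕ.+ e)

  order : ℕ
  order = suc p ℕ.* (3 ℕ.+ e)

  vertex : Block → Position → Fin order
  vertex = combine

  block : Fin order → Block
  block v = proj₁ (remQuot {suc p} (3 ℕ.+ e) v)

  pos : Fin order → Position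
  pos v = proj₂ (remQuot {suc p} (3 ℕ.+ e) v)

  block-vertex : ∀ b i → block (vertex b i) ≡ b
  block-vertex b i = cong proj₁ (Fin.remQuot-combine b i)

  pos-vertex : ∀ b i → pos (vertex b i) ≡ i
  pos-vertex b i = cong proj₂ (Fin.remQuot-combine b i)

  vertex-block-pos : ∀ v → vertex (block v) (pos v) ≡ v
  vertex-block-pos = Fin.combine-remQuot {suc p} (3 ℕ.+ e)

  -- The block of the neighbour at position `j` of a vertex at position `i` of block `b`; only the
  -- pair of positions 0 and 1 can lead to another block. With a single block `prev` and `next` are
  -- the identity, and the graph is complete.
  shift : Position → Position → Block → Block
  shift zero       (suc zero) b = prev b
  shift (suc zero) zero       b = next b
  shift _          _          b = b

  shift-inverse : ∀ i j b → shift j i (shift i j b) ≡ b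
  shift-inverse zero          zero          b = refl
  shift-inverse zero          (suc zero)    b = next-prev b
  shift-inverse zero          (suc (suc _)) b = refl
  shift-inverse (suc zero)    zero          b = prev-next b
  shift-inverse (suc zero)    (suc zero)    b = refl
  shift-inverse (suc zero)    (suc (suc _)) b = refl
  shift-inverse (suc (suc _)) zero          b = refl
  shift-inverse (suc (suc _)) (suc zero)    b = refl
  shift-inverse (suc (suc _)) (suc (suc _)) b = refl

  shift-refl : ∀ i b → shift i i b ≡ b
  shift-refl zero          b = refl
  shift-refl (suc zero)    b = refl
  shift-refl (suc (suc _)) b = refl

  shift-interior : ∀ i j b → shift i (suc (suc j)) b ≡ b
  shift-interior zero          j b = refl
  shift-interior (suc zero)    j b = refl
  shift-interior (suc (suc _)) j b = refl

  necklace : Graph order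
  necklace = record
    { Adj        = λ u v → pos u ≢ pos v × block v ≡ shift (pos u) (pos v) (block u)
    ; adj?       = λ u v → ¬? (pos u Fin.≟ pos v) ×-dec (block v Fin.≟ shift (pos u) (pos v) (block u))
    ; Adj-sym    = λ {u} {v} (i≢j , eq) → ≢-sym i≢j ,
                     trans (sym (shift-inverse (pos u) (pos v) (block u))) (cong (shift (pos v) (pos u)) (sym eq))
    ; Adj-irrefl = λ { refl (i≢i , _) → i≢i refl }
    }

  -- The one vertex at position `j` in the closed neighbourhood of `u`. As `shift i i` is the
  -- identity, it is `u` itself when `j` is the position of `u`.
  nbr : Fin order → Position → Fin order
  nbr u j = vertex (shift (pos u) j (block u)) j

  nbr-position : ∀ u j → pos (nbr u j) ≡ j
  nbr-position u j = pos-vertex (shift (pos u) j (block u)) j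

  nbr-adj : ∀ u {j} → pos u ≢ j → Adj necklace u (nbr u j)
  nbr-adj u {j} i≢j rewrite pos-vertex (shift (pos u) j (block u)) j | block-vertex (shift (pos u) j (block u)) j = i≢j , refl

  nbr-pos : ∀ u → nbr u (pos u) ≡ u
  nbr-pos u = trans (cong (λ b → vertex b (pos u)) (shift-refl (pos u) (block u))) (vertex-block-pos u)

  adj⇒nbr : ∀ u v → Adj necklace u v → v ≡ nbr u (pos v)
  adj⇒nbr u v (_ , eq) = trans (sym (vertex-block-pos v)) (cong (λ b → vertex b (pos v)) eq)

  nbr-closed : ∀ u j → nbr u j ≡ u ⊎ Adj necklace u (nbr u j)
  nbr-closed u j with pos u Fin.≟ j
  ... | yes refl = inj₁ (nbr-pos u)
  ... | no  i≢j  = inj₂ (nbr-adj u i≢j)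

  -- The neighbours of `u` correspond to the positions other than its own, which `punchIn (pos u)`
  -- enumerates; the two lists contain each other and have no repetitions.
  necklace-regular : Regular necklace (2 ℕ.+ e)
  necklace-regular u = trans
    (ℕ.≤-antisym (Unique-⊆⇒length-≤ (Unique.filter⁺ (adj? necklace u) (Unique.allFin⁺ order)) to)
                 (Unique-⊆⇒length-≤ (Unique.map⁺ f-injective (Unique.allFin⁺ (2 ℕ.+ e))) from))
    (trans (length-map f (allFin (2 ℕ.+ e))) (length-tabulate {n = 2 ℕ.+ e} id))
    where
    f : Fin (2 ℕ.+ e) → Fin order
    f = nbr u ∘ punchIn (pos u)
    f-injective : ∀ {i j} → f i ≡ f j → i ≡ j
    f-injective {i} {j} eq = Fin.punchIn-injective (pos u) i j
      (trans (sym (nbr-position u (punchIn (pos u) i))) (trans (cong pos eq) (nbr-position u (punchIn (pos u) j))))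
    to : ∀ {v} → v ∈ filter (adj? necklace u) (allFin order) → v ∈ map f (allFin (2 ℕ.+ e))
    to {v} v∈ with _ , adj ← ∈-filter⁻ (adj? necklace u) {xs = allFin order} v∈ =
      subst (_∈ map f (allFin (2 ℕ.+ e)))
        (trans (cong (nbr u) (Fin.punchIn-punchOut (proj₁ adj))) (sym (adj⇒nbr u v adj)))
        (∈-map⁺ f (∈-allFin (punchOut (proj₁ adj))))
    from : ∀ {v} → v ∈ map f (allFin (2 ℕ.+ e)) → v ∈ filter (adj? necklace u) (allFin order)
    from v∈ with i , _ , refl ← ∈-map⁻ f v∈ =
      ∈-filter⁺ (adj? necklace u) (∈-allFin (f i)) (nbr-adj u (≢-sym (Fin.punchInᵢ≢i (pos u) i)))

  private
    Path : Fin order → Fin order → Set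
    Path = Star (Adj necklace)

    edge : ∀ b i j → i ≢ j → Path (vertex b i) (vertex (shift i j b) j)
    edge b i j i≢j = subst (Adj necklace (vertex b i)) target
        (nbr-adj (vertex b i) (subst (_≢ j) (sym (pos-vertex b i)) i≢j)) ◅ Star.ε
      where
      target : nbr (vertex b i) j ≡ vertex (shift i j b) j
      target = cong₂ (λ k c → vertex (shift k j c) j) (pos-vertex b i) (block-vertex b i)

    back : ∀ {u v} → Path u v → Path v u
    back = reverse (λ {u} {v} → Adj-sym necklace {u} {v})

    -- Position 2 is interior, so it is adjacent to all other positions of its own block.
    centre : Block → Fin order
    centre b = vertex b (suc (suc zero))

    to-centre : ∀ b i → Path (vertex b i) (centre b)
    to-centre b zero                = edge b _ (suc (suc zero)) λ ()
    to-centre b (suc zero)          = edge b _ (suc (suc zero)) λ ()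
    to-centre b (suc (suc zero))    = Star.ε
    to-centre b (suc (suc (suc i))) = edge b _ (suc (suc zero)) λ ()

    -- The middle edge is the link between the blocks, from position 0 of `b` to position 1 of
    -- `prev b`.
    centre-step : ∀ b → Path (centre b) (centre (prev b))
    centre-step b = edge b _ zero (λ ()) ◅◅ edge b zero (suc zero) (λ ()) ◅◅ edge (prev b) _ (suc (suc zero)) λ ()

  necklace-connected : Connected necklace
  necklace-connected = vertex zero zero , λ u v → to-root u ◅◅ back (to-root v)
    where
    -- The induction runs on the index of the block as a number, because `inject₁ j` is not
    -- structurally smaller than `suc j`.
    descend : ∀ n (b : Block) → toℕ b ≡ n → Path (centre b) (centre zero)
    descend n       zero    eq = Star.ε
    descend (suc n) (suc j) eq = centre-step (suc j) ◅◅
      descend n (inject₁ j) (trans (Fin.toℕ-inject₁ j) (ℕ.suc-injective eq))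
    to-root : ∀ v → Path v (centre zero)
    to-root v = subst (λ w → Path w (centre zero)) (vertex-block-pos v)
      (to-centre (block v) (pos v) ◅◅ descend _ (block v) refl)

  -- Frozen colourings of the necklace and their recolourings

  Colour : Set
  Colour = Fin (3 ℕ.+ e)

  -- `lift 2` fixes the colours 0 and 1, so positions 0 and 1 look the same in every block, and
  -- `π b` only rearranges the interior colours.
  Rainbow : (Block → Fin (suc e) → Fin (suc e)) → (Fin order → Colour) → Set
  Rainbow π β = ∀ v → β v ≡ lift 2 (π (block v)) (pos v)

  module _ {π : Block → Fin (suc e) → Fin (suc e)} (π-inj : ∀ b → Injective _≡_ _≡_ (π b)) {β} (rainbow : Rainbow π β) where

    private
      -- A link joins colours 0 and 1, and every edge between interior positions stays in one block,
      -- where `π b` is injective.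
      separated : ∀ b i j → i ≢ j → lift 2 (π b) i ≢ lift 2 (π (shift i j b)) j
      separated b zero          zero          i≢j _  = i≢j refl
      separated b zero          (suc zero)    i≢j ()
      separated b zero          (suc (suc j)) i≢j ()
      separated b (suc zero)    zero          i≢j ()
      separated b (suc zero)    (suc zero)    i≢j _  = i≢j refl
      separated b (suc zero)    (suc (suc j)) i≢j ()
      separated b (suc (suc i)) (suc zero)    i≢j ()
      separated b (suc (suc i)) (suc (suc j)) i≢j eq = i≢j (Fin.lift-injective (π b) (π-inj b) 2 eq)

      -- Colours 0 and 1 occur at positions 0 and 1 of any block; the interior part of a closed
      -- neighbourhood lies in block `b`, where `π b` is onto.
      attained : ∀ i b c → ∃ λ j → lift 2 (π (shift i j b)) j ≡ c
      attained i b zero          = zero , refl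
      attained i b (suc zero)    = suc zero , refl
      attained i b (suc (suc c)) with j , eq ← injective⇒surjective (π-inj b) c =
        suc (suc j) , cong (λ c → suc (suc c)) (trans (cong (λ b → π b j) (shift-interior i j b)) eq)

      β-vertex : ∀ b j → β (vertex b j) ≡ lift 2 (π b) j
      β-vertex b j = trans (rainbow (vertex b j)) (cong₂ (λ b → lift 2 (π b)) (block-vertex b j) (pos-vertex b j))

    rainbow⇒proper : Proper necklace β
    rainbow⇒proper u v (i≢j , eq) same = separated (block u) (pos u) (pos v) i≢j
      (trans (sym (rainbow u)) (trans same (trans (rainbow v) (cong (λ b → lift 2 (π b) (pos v)) eq))))

    rainbow⇒frozen : Frozen necklace β
    rainbow⇒frozen v c with j , eq ← attained (pos v) (block v) c =
      nbr v j , nbr-closed v j , trans (β-vertex (shift (pos v) j (block v)) j) eq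

  -- The colour of position 0, the other colour missing from the interior
  -- (relative to the first), and whether position 1 repeats position 0.
  Code : Set
  Code = Fin (3 ℕ.+ e) × Fin (2 ℕ.+ e) × Fin 2

  -- A bijective renaming of the colours: each `punchIn` skips a colour that is already taken, and
  -- the interior colours keep their order.
  palette : Fin (3 ℕ.+ e) → Fin (2 ℕ.+ e) → Colour → Colour
  palette a b zero          = a
  palette a b (suc zero)    = punchIn a b
  palette a b (suc (suc c)) = punchIn a (punchIn b c)

  recolour : Position → Code → Colour → Colour
  recolour (suc zero) (a , b , suc _) _ = a
  recolour _          (a , b , _)     c = palette a b c

  -- The hypothesis says that all pairs of positions except 0 and 1 get different colours. Position
  -- 0 and the interior then use all colours but one, and position 1, which differs from the
  -- interior, has either that last colour or the colour of position 0.
  recode : (χ : Position → Colour) → (∀ i j → i ≢ suc (suc j) → χ i ≢ χ (suc (suc j))) →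
    ∃₂ λ (κ : Code) (π : Fin (suc e) → Fin (suc e)) →
      Injective _≡_ _≡_ π × (∀ i → χ i ≡ recolour i κ (lift 2 π i))
  recode χ χ-inj = construct other
    where
    first : Fin (2 ℕ.+ e) → Colour
    first zero    = χ zero
    first (suc i) = χ (suc (suc i))

    other : ∃ λ y → (∀ i → first i ≢ y) × (χ (suc zero) ≡ y ⊎ χ (suc zero) ≡ χ zero)
    other with χ (suc zero) Fin.≟ χ zero
    -- Position 1 brings no new colour, so the second exceptional colour is one that no position of
    -- the block has.
    ... | yes same with y , y∉ ← missed first = y , y∉ , inj₂ same
    ... | no  diff = χ (suc zero) , distinct , inj₁ refl
      where
      distinct : ∀ i → first i ≢ χ (suc zero)
      distinct zero    eq = diff (sym eq)
      distinct (suc i) eq = χ-inj (suc zero) i (λ ()) (sym eq)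

    construct : (∃ λ y → (∀ i → first i ≢ y) × (χ (suc zero) ≡ y ⊎ χ (suc zero) ≡ χ zero)) →
      ∃₂ λ (κ : Code) (π : Fin (suc e) → Fin (suc e)) →
        Injective _≡_ _≡_ π × (∀ i → χ i ≡ recolour i κ (lift 2 π i))
    construct (y , y∉ , match) = choose match
      where
      a = χ zero
      b = punchOut (y∉ zero)

      a≢ : ∀ i → a ≢ χ (suc (suc i))
      a≢ i = χ-inj zero i λ ()

      b≢ : ∀ i → b ≢ punchOut (a≢ i)
      b≢ i eq = y∉ (suc i) (sym (Fin.punchOut-injective (y∉ zero) (a≢ i) eq))

      -- Interior colours avoid both `a` and `y`; deleting these two from the palette leaves
      -- `Fin (suc e)`.
      π : Fin (suc e) → Fin (suc e)
      π i = punchOut (b≢ i)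

      π-correct : ∀ i → χ (suc (suc i)) ≡ punchIn a (punchIn b (π i))
      π-correct i = sym (trans (cong (punchIn a) (Fin.punchIn-punchOut (b≢ i))) (Fin.punchIn-punchOut (a≢ i)))

      π-injective : Injective _≡_ _≡_ π
      π-injective {i} {j} eq with i Fin.≟ j
      ... | yes i≡j = i≡j
      ... | no  i≢j = contradiction
        (trans (π-correct i) (trans (cong (λ c → punchIn a (punchIn b c)) eq) (sym (π-correct j))))
        (χ-inj (suc (suc i)) j λ eq′ → i≢j (Fin.suc-injective (Fin.suc-injective eq′)))

      choose : (χ (suc zero) ≡ y ⊎ χ (suc zero) ≡ χ zero) →
        ∃₂ λ (κ : Code) (π : Fin (suc e) → Fin (suc e)) →
          Injective _≡_ _≡_ π × (∀ i → χ i ≡ recolour i κ (lift 2 π i))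
      choose (inj₁ fresh) = (a , b , zero) , π , π-injective , λ where
        zero          → refl
        (suc zero)    → trans fresh (sym (Fin.punchIn-punchOut (y∉ zero)))
        (suc (suc i)) → π-correct i
      choose (inj₂ same) = (a , b , suc zero) , π , π-injective , λ where
        zero          → refl
        (suc zero)    → same
        (suc (suc i)) → π-correct i

  encodeCode : Code → Fin (cost (2 ℕ.+ e))
  encodeCode (a , b , s) = combine a (combine b s)

  decodeCode : Fin (cost (2 ℕ.+ e)) → Code
  decodeCode w = map₂ (remQuot {2 ℕ.+ e} 2) (remQuot {3 ℕ.+ e} ((2 ℕ.+ e) ℕ.* 2) w)

  decode-encode : ∀ κ → decodeCode (encodeCode κ) ≡ κ
  decode-encode (a , b , s) = trans
    (cong (map₂ (remQuot {2 ℕ.+ e} 2)) (Fin.remQuot-combine a (combine b s)))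
    (cong (a ,_) (Fin.remQuot-combine b s))

  -- The number `w` packs one code for each block, so the recolourings are enumerated by `allFin`.
  recolouring : (Fin order → Colour) → Fin (cost (2 ℕ.+ e) ℕ.^ suc p) → Fin order → Colour
  recolouring β w v = recolour (pos v) (decodeCode (finToFun w (block v))) (β v)

  proper-recolouring : ∀ α → Proper necklace α → ∃₂ λ (π : Block → Fin (suc e) → Fin (suc e)) w →
    (∀ b → Injective _≡_ _≡_ (π b)) ×
    (∀ β → Rainbow π β → recolouring β w ≗ α)
  proper-recolouring α proper = (λ b → proj₁ (proj₂ (codes b))) , funToFin (encodeCode ∘ κ) ,
      (λ b → proj₁ (proj₂ (proj₂ (codes b)))) , correct
    where
    codes : ∀ b → ∃₂ λ (κ : Code) (π : Fin (suc e) → Fin (suc e)) →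
      Injective _≡_ _≡_ π × (∀ i → α (vertex b i) ≡ recolour i κ (lift 2 π i))
    codes b = recode (λ i → α (vertex b i)) λ i j i≢j → proper (vertex b i) (vertex b (suc (suc j)))
      (subst₂ _≢_ (sym (pos-vertex b i)) (sym (pos-vertex b (suc (suc j)))) i≢j ,
       trans (block-vertex b (suc (suc j))) (sym (begin
         shift (pos (vertex b i)) (pos (vertex b (suc (suc j)))) (block (vertex b i))
           ≡⟨ cong₂ (shift (pos (vertex b i))) (pos-vertex b (suc (suc j))) (block-vertex b i) ⟩
         shift (pos (vertex b i)) (suc (suc j)) b
           ≡⟨ shift-interior (pos (vertex b i)) j b ⟩
         b ∎)))
      where open ≡-Reasoning
    κ : Block → Code
    κ b = proj₁ (codes b)
    correct : ∀ β → Rainbow (λ b → proj₁ (proj₂ (codes b))) β → recolouring β (funToFin (encodeCode ∘ κ)) ≗ α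
    correct β rainbow v = begin
      recolour (pos v) (decodeCode (finToFun (funToFin (encodeCode ∘ κ)) (block v))) (β v)
        ≡⟨ cong₂ (recolour (pos v)) (trans (cong decodeCode (Fin.finToFun-funToFin (encodeCode ∘ κ) (block v))) (decode-encode (κ (block v)))) (rainbow v) ⟩
      recolour (pos v) (κ (block v)) (lift 2 (proj₁ (proj₂ (codes (block v)))) (pos v))
        ≡⟨ proj₂ (proj₂ (proj₂ (codes (block v)))) (pos v) ⟨
      α (vertex (block v) (pos v))
        ≡⟨ cong α (vertex-block-pos v) ⟩
      α v ∎
      where open ≡-Reasoning

  -- Comparing the numbers of proper and frozen colourings

  private
    Δ+1 = 3 ℕ.+ e

    -- `Ω` lists functions of the form `finToFun x`, and membership means propositional equality;
    -- this picks the listed function that agrees pointwise with `f`.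
    normal : (Fin order → Colour) → Fin order → Colour
    normal f = finToFun (funToFin f)

    normal-∈ : ∀ f → normal f ∈ map finToFun (allFin (Δ+1 ℕ.^ order))
    normal-∈ f = ∈-map⁺ finToFun (∈-allFin (funToFin f))

    rainbow : (Block → Fin (suc e) → Fin (suc e)) → Fin order → Colour
    rainbow π = normal (λ v → lift 2 (π (block v)) (pos v))

    rainbow-rainbow : ∀ π → Rainbow π (rainbow π)
    rainbow-rainbow π = Fin.finToFun-funToFin (λ v → lift 2 (π (block v)) (pos v))

    rainbow-∈-Ω : ∀ {π} → (∀ b → Injective _≡_ _≡_ (π b)) → rainbow π ∈ Ω necklace Δ+1
    rainbow-∈-Ω {π} π-inj = ∈-filter⁺ (proper? necklace) (normal-∈ λ v → lift 2 (π (block v)) (pos v)) (rainbow⇒proper π-inj (rainbow-rainbow π))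

  FrozenΩ : List (Fin order → Colour)
  FrozenΩ = filter (frozen? necklace) (Ω necklace Δ+1)

  -- Rules out the conventional value of `Pr` on the empty list.
  Ω-nonempty : ∃ λ α → α ∈ Ω necklace Δ+1
  Ω-nonempty = rainbow (λ _ i → i) , rainbow-∈-Ω λ _ eq → eq

  -- Each proper colouring comes from a frozen one and a choice of codes, so the list of all such
  -- pairs, possibly with repetitions, covers the repetition-free list `Ω`.
  length-Ω-≤ : length (Ω necklace Δ+1) ℕ.≤ length FrozenΩ ℕ.* cost (2 ℕ.+ e) ℕ.^ suc p
  length-Ω-≤ = begin
    length (Ω necklace Δ+1)
      ≤⟨ Unique-⊆⇒length-≤ Ω-unique covered ⟩
    length (cartesianProductWith g FrozenΩ codes)
      ≡⟨ length-cartesianProductWith g FrozenΩ codes ⟩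
    length FrozenΩ ℕ.* length codes
      ≡⟨ cong (length FrozenΩ ℕ.*_) (length-tabulate {n = cost (2 ℕ.+ e) ℕ.^ suc p} id) ⟩
    length FrozenΩ ℕ.* cost (2 ℕ.+ e) ℕ.^ suc p ∎
    where
    open ℕ.≤-Reasoning
    codes = allFin (cost (2 ℕ.+ e) ℕ.^ suc p)
    g : (Fin order → Colour) → Fin (cost (2 ℕ.+ e) ℕ.^ suc p) → Fin order → Colour
    g β w = normal (recolouring β w)
    Ω-unique : Unique (Ω necklace Δ+1)
    Ω-unique = Unique.filter⁺ (proper? necklace) (Unique.map⁺ (finToFun-injective {Δ+1} {order}) (Unique.allFin⁺ _))
    attained : ∀ x → (∃₂ λ (π : Block → Fin (suc e) → Fin (suc e)) w →
        (∀ b → Injective _≡_ _≡_ (π b)) × (∀ β → Rainbow π β → recolouring β w ≗ finToFun x)) →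
      finToFun x ∈ cartesianProductWith g FrozenΩ codes
    -- Pointwise equality becomes equality of the numbers given by `funToFin`, and hence of the
    -- listed functions.
    attained x (π , w , π-inj , correct) = subst (_∈ cartesianProductWith g FrozenΩ codes)
      (cong finToFun (trans (funToFin-cong (correct (rainbow π) (rainbow-rainbow π))) (Fin.funToFin-finToFin {order} {Δ+1} x)))
      (∈-cartesianProductWith⁺ g
        (∈-filter⁺ (frozen? necklace) (rainbow-∈-Ω π-inj) (rainbow⇒frozen π-inj (rainbow-rainbow π)))
        (∈-allFin w))
    covered′ : ∀ {α} → (∃ λ x → x ∈ allFin (Δ+1 ℕ.^ order) × α ≡ finToFun x) → Proper necklace α →
      α ∈ cartesianProductWith g FrozenΩ codes
    covered′ (x , _ , refl) proper = attained x (proper-recolouring (finToFun x) proper)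
    covered : ∀ {α} → α ∈ Ω necklace Δ+1 → α ∈ cartesianProductWith g FrozenΩ codes
    covered {α} α∈ = covered′ (∈-map⁻ finToFun (proj₁ split)) (proj₂ split)
      where
      split : α ∈ map finToFun (allFin (Δ+1 ℕ.^ order)) × Proper necklace α
      split = ∈-filter⁻ (proper? necklace) α∈

module Analysis where

  import Data.Integer.Base as ℤ
  import Data.Integer.Properties as ℤ
  open import Data.Rational.Base renaming (∣_∣ to abs)
  open import Data.Rational.Properties
  open import Data.Rational.Unnormalised.Base as ℚᵘ using (mkℚᵘ; *≡*; *≤*)
  import Data.Rational.Unnormalised.Properties as ℚᵘ
  open import Algebra.Definitions.RawSemiring +-*-rawSemiring using (_^_)
  open import Data.Rational.Solver
  open +-*-Solver using (solve; _:+_; _:*_; _:-_; :-_; _:=_; con)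

  -- Rational arithmetic and finite sums

  infixl 7 _×₊_

  ι : ℕ → ℚ
  ι n = + n / 1

  _×₊_ : ∀ {p q} → 0ℚ ≤ p → 0ℚ ≤ q → 0ℚ ≤ p * q
  _×₊_ {p} {q} 0≤p 0≤q = subst (_≤ p * q) (*-zeroˡ q) (*-monoʳ-≤-nonNeg q {{nonNegative 0≤q}} 0≤p)

  toℚᵘ-/ : ∀ i d → toℚᵘ (i / suc d) ℚᵘ.≃ mkℚᵘ i d
  toℚᵘ-/ i d = toℚᵘ-fromℚᵘ (mkℚᵘ i d)

  /-mono-≤ : ∀ a b c d .{{_ : ℕ.NonZero b}} .{{_ : ℕ.NonZero d}} →
             a ℕ.* d ℕ.≤ c ℕ.* b → + a / b ≤ + c / d
  /-mono-≤ a (suc b) c (suc d) h = toℚᵘ-cancel-≤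
    (ℚᵘ.≤-respˡ-≃ (ℚᵘ.≃-sym (toℚᵘ-/ (+ a) b))
      (ℚᵘ.≤-respʳ-≃ (ℚᵘ.≃-sym (toℚᵘ-/ (+ c) d))
        (*≤* (subst₂ ℤ._≤_ (ℤ.pos-* a (suc d)) (ℤ.pos-* c (suc b)) (ℤ.+≤+ h)))))

  ι-mono : ∀ {m n} → m ℕ.≤ n → ι m ≤ ι n
  ι-mono {m} {n} h = /-mono-≤ m 1 n 1 (ℕ.*-monoˡ-≤ 1 h)

  0≤/ : ∀ a b .{{_ : ℕ.NonZero b}} → 0ℚ ≤ + a / b
  0≤/ a b = /-mono-≤ 0 1 a b ℕ.z≤n

  0≤ι : ∀ n → 0ℚ ≤ ι n
  0≤ι n = 0≤/ n 1

  ι-+ : ∀ m n → ι (m ℕ.+ n) ≡ ι m + ι n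
  ι-+ m n = toℚᵘ-injective (begin
    toℚᵘ (ι (m ℕ.+ n))               ≈⟨ toℚᵘ-/ _ 0 ⟩
    mkℚᵘ (+ (m ℕ.+ n)) 0             ≈⟨ *≡* (cong (ℤ._* + 1) (cong₂ ℤ._+_ (sym (ℤ.*-identityʳ (+ m))) (sym (ℤ.*-identityʳ (+ n))))) ⟩
    mkℚᵘ (+ m) 0 ℚᵘ.+ mkℚᵘ (+ n) 0   ≈⟨ ℚᵘ.+-cong (toℚᵘ-/ (+ m) 0) (toℚᵘ-/ (+ n) 0) ⟨
    toℚᵘ (ι m) ℚᵘ.+ toℚᵘ (ι n)       ≈⟨ toℚᵘ-homo-+ (ι m) (ι n) ⟨
    toℚᵘ (ι m + ι n)                 ∎)
    where open ℚᵘ.≃-Reasoning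

  ι-* : ∀ m n → ι (m ℕ.* n) ≡ ι m * ι n
  ι-* zero    n = sym (*-zeroˡ (ι n))
  ι-* (suc m) n = begin
    ι (n ℕ.+ m ℕ.* n)     ≡⟨ ι-+ n (m ℕ.* n) ⟩
    ι n + ι (m ℕ.* n)     ≡⟨ cong (_+_ (ι n)) (ι-* m n) ⟩
    ι n + ι m * ι n       ≡⟨ solve 2 (λ m n → n :+ m :* n := (con 1ℚ :+ m) :* n) refl (ι m) (ι n) ⟩
    (1ℚ + ι m) * ι n      ≡⟨ cong (_* ι n) (ι-+ 1 m) ⟨
    ι (suc m) * ι n       ∎
    where open ≡-Reasoning

  /-*-cancel : ∀ a b .{{_ : ℕ.NonZero b}} → (+ a / b) * ι b ≡ ι a
  /-*-cancel a (suc b) = toℚᵘ-injective (begin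
    toℚᵘ ((+ a / suc b) * ι (suc b))              ≈⟨ toℚᵘ-homo-* (+ a / suc b) (ι (suc b)) ⟩
    toℚᵘ (+ a / suc b) ℚᵘ.* toℚᵘ (ι (suc b))      ≈⟨ ℚᵘ.*-cong (toℚᵘ-/ (+ a) b) (toℚᵘ-/ (+ suc b) 0) ⟩
    mkℚᵘ (+ a) b ℚᵘ.* mkℚᵘ (+ suc b) 0            ≈⟨ *≡* (trans (ℤ.*-identityʳ _) (cong (λ z → + a ℤ.* (+ z)) (sym (ℕ.*-identityʳ (suc b))))) ⟩
    mkℚᵘ (+ a) 0                                  ≈⟨ toℚᵘ-/ (+ a) 0 ⟨
    toℚᵘ (ι a)                                    ∎)
    where open ℚᵘ.≃-Reasoning

  ι-cancelˡ-≤ : ∀ n .{{_ : ℕ.NonZero n}} {p q} → ι n * p ≤ ι n * q → p ≤ q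
  ι-cancelˡ-≤ n = *-cancelˡ-≤-pos (ι n) {{normalize-pos n 1}}

  ι-cancelˡ-≡ : ∀ n .{{_ : ℕ.NonZero n}} {p q} → ι n * p ≡ ι n * q → p ≡ q
  ι-cancelˡ-≡ n e = ≤-antisym (ι-cancelˡ-≤ n (≤-reflexive e)) (ι-cancelˡ-≤ n (≤-reflexive (sym e)))

  ∑<-cong : ∀ n {f g} → (∀ i → i ℕ.< n → f i ≡ g i) → ∑< n f ≡ ∑< n g
  ∑<-cong zero    h = refl
  ∑<-cong (suc n) h = cong₂ _+_ (∑<-cong n λ i i<n → h i (ℕ.m<n⇒m<1+n i<n)) (h n ℕ.≤-refl)

  ∑<-mono : ∀ n {f g} → (∀ i → i ℕ.< n → f i ≤ g i) → ∑< n f ≤ ∑< n g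
  ∑<-mono zero    h = ≤-refl
  ∑<-mono (suc n) h = +-mono-≤ (∑<-mono n λ i i<n → h i (ℕ.m<n⇒m<1+n i<n)) (h n ℕ.≤-refl)

  ∑<-+ : ∀ n f g → ∑< n (λ i → f i + g i) ≡ ∑< n f + ∑< n g
  ∑<-+ zero    f g = refl
  ∑<-+ (suc n) f g = trans (cong (_+ (f n + g n)) (∑<-+ n f g))
    (solve 4 (λ a b c d → (a :+ b) :+ (c :+ d) := (a :+ c) :+ (b :+ d)) refl (∑< n f) (∑< n g) (f n) (g n))

  ∑<-*ˡ : ∀ n c f → ∑< n (λ i → c * f i) ≡ c * ∑< n f
  ∑<-*ˡ zero    c f = sym (*-zeroʳ c)
  ∑<-*ˡ (suc n) c f = trans (cong (_+ c * f n) (∑<-*ˡ n c f)) (sym (*-distribˡ-+ c (∑< n f) (f n)))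

  ∑<-*ʳ : ∀ n c f → ∑< n (λ i → f i * c) ≡ ∑< n f * c
  ∑<-*ʳ zero    c f = sym (*-zeroˡ c)
  ∑<-*ʳ (suc n) c f = trans (cong (_+ f n * c) (∑<-*ʳ n c f)) (sym (*-distribʳ-+ c (∑< n f) (f n)))

  ∑<-suc : ∀ n f → ∑< (suc n) f ≡ f 0 + ∑< n (f ∘ suc)
  ∑<-suc zero    f = +-comm 0ℚ (f 0)
  ∑<-suc (suc n) f = trans (cong (_+ f (suc n)) (∑<-suc n f)) (+-assoc (f 0) _ _)

  ∑<-extend : ∀ d n {f} → (∀ i → 0ℚ ≤ f i) → ∑< n f ≤ ∑< (d ℕ.+ n) f
  ∑<-extend zero    n h = ≤-refl
  ∑<-extend (suc d) n {f} h = ≤-trans (∑<-extend d n h)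
    (subst (_≤ ∑< (d ℕ.+ n) f + f (d ℕ.+ n)) (+-identityʳ _) (+-monoʳ-≤ (∑< (d ℕ.+ n) f) (h (d ℕ.+ n))))

  ∑<-extend-≤ : ∀ {m n f} → (∀ i → 0ℚ ≤ f i) → m ℕ.≤ n → ∑< m f ≤ ∑< n f
  ∑<-extend-≤ {m} {n} {f} h m≤n = subst (λ z → ∑< m f ≤ ∑< z f) (ℕ.m∸n+n≡m m≤n) (∑<-extend (n ℕ.∸ m) m h)

  0≤∑< : ∀ n {f} → (∀ i → 0ℚ ≤ f i) → 0ℚ ≤ ∑< n f
  0≤∑< n h = ∑<-extend-≤ {0} {n} h ℕ.z≤n

  -- Partial sums of the exponential series: products and tails

  expTerm-suc : ∀ x j → ι (suc j) * expTerm x (suc j) ≡ x * expTerm x j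
  expTerm-suc x j = begin
    s * (x * p * g)                  ≡⟨ solve 4 (λ s x p g → s :* (x :* p :* g) := x :* p :* (s :* g)) refl s x p g ⟩
    x * p * (s * g)                  ≡⟨ cong (x * p *_) step ⟩
    x * p * f                        ≡⟨ *-assoc x p f ⟩
    x * (p * f)                      ∎
    where
    open ≡-Reasoning
    instance
      _ = j ℕ.!≢0
      _ = suc j ℕ.!≢0
    s = ι (suc j)
    p = x ^ j
    f = + 1 / j !
    g = + 1 / suc j !
    step : s * g ≡ f
    step = begin
      s * g                    ≡⟨ solve 2 (λ s g → s :* g := s :* g :* con 1ℚ) refl s g ⟩
      s * g * 1ℚ               ≡⟨ cong (s * g *_) (/-*-cancel 1 (j !)) ⟨
      s * g * (f * ι (j !))    ≡⟨ solve 4 (λ s g f h → s :* g :* (f :* h) := f :* (g :* (s :* h))) refl s g f (ι (j !)) ⟩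
      f * (g * (s * ι (j !)))  ≡⟨ cong (λ z → f * (g * z)) (ι-* (suc j) (j !)) ⟨
      f * (g * ι (suc j !))    ≡⟨ cong (f *_) (/-*-cancel 1 (suc j !)) ⟩
      f * 1ℚ                   ≡⟨ *-identityʳ f ⟩
      f                        ∎

  ^-nonNeg : ∀ {x} → 0ℚ ≤ x → ∀ j → 0ℚ ≤ x ^ j
  ^-nonNeg h zero    = 0≤/ 1 1
  ^-nonNeg h (suc j) = h ×₊ ^-nonNeg h j

  ^-mono : ∀ {x y} → 0ℚ ≤ x → x ≤ y → ∀ j → x ^ j ≤ y ^ j
  ^-mono h x≤y zero    = ≤-refl
  ^-mono {x} {y} h x≤y (suc j) = ≤-trans
    (*-monoʳ-≤-nonNeg (x ^ j) {{nonNegative (^-nonNeg h j)}} x≤y)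
    (*-monoˡ-≤-nonNeg y {{nonNegative (≤-trans h x≤y)}} (^-mono h x≤y j))

  -- The two bounds are proved together, since multiplication by `- x` turns each into the other.
  -‿^-bounds : ∀ {x} → 0ℚ ≤ x → ∀ j → (- x) ^ j ≤ x ^ j × - (x ^ j) ≤ (- x) ^ j
  -‿^-bounds h zero = ≤-refl , ≤-trans (neg-antimono-≤ (0≤/ 1 1)) (0≤/ 1 1)
  -‿^-bounds {x} h (suc j) with u , l ← -‿^-bounds h j =
    (begin
      (- x) * (- x) ^ j    ≡⟨ solve 2 (λ x p → :- x :* p := x :* :- p) refl x ((- x) ^ j) ⟩
      x * - ((- x) ^ j)    ≤⟨ *-monoˡ-≤-nonNeg x {{nonNegative h}} (neg-antimono-≤ l) ⟩
      x * - - (x ^ j)      ≡⟨ solve 2 (λ x p → x :* :- :- p := x :* p) refl x (x ^ j) ⟩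
      x * x ^ j            ∎) ,
    (begin
      - (x * x ^ j)        ≡⟨ solve 2 (λ x p → :- (x :* p) := x :* :- p) refl x (x ^ j) ⟩
      x * - (x ^ j)        ≤⟨ *-monoˡ-≤-nonNeg x {{nonNegative h}} (neg-antimono-≤ u) ⟩
      x * - ((- x) ^ j)    ≡⟨ solve 2 (λ x p → x :* :- p := :- x :* p) refl x ((- x) ^ j) ⟩
      (- x) * (- x) ^ j    ∎)
    where open ≤-Reasoning

  0≤1/! : ∀ j → 0ℚ ≤ (+ 1 / j !) {{j ℕ.!≢0}}
  0≤1/! j = 0≤/ 1 (j !) {{j ℕ.!≢0}}

  module _ {x} (0≤x : 0ℚ ≤ x) where

    0≤expTerm : ∀ j → 0ℚ ≤ expTerm x j
    0≤expTerm j = ^-nonNeg 0≤x j ×₊ 0≤1/! j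

    0≤expSum : ∀ k → 0ℚ ≤ expSum k x
    0≤expSum k = 0≤∑< k 0≤expTerm

    expTerm-neg-≤ : ∀ j → expTerm (- x) j ≤ expTerm x j
    expTerm-neg-≤ j = *-monoʳ-≤-nonNeg _ {{nonNegative (0≤1/! j)}} (proj₁ (-‿^-bounds 0≤x j))

    expTerm-mono : ∀ {y} → x ≤ y → ∀ j → expTerm x j ≤ expTerm y j
    expTerm-mono x≤y j = *-monoʳ-≤-nonNeg _ {{nonNegative (0≤1/! j)}} (^-mono 0≤x x≤y j)

    expSum-mono : ∀ {y} → x ≤ y → ∀ k → expSum k x ≤ expSum k y
    expSum-mono x≤y k = ∑<-mono k λ i _ → expTerm-mono x≤y i

    -- A termwise comparison, which carries a tail estimate at one argument over to all smaller
    -- nonnegative ones.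
    expSum-tail-mono : ∀ {y} → x ≤ y → ∀ d k →
      expSum (d ℕ.+ k) x - expSum k x ≤ expSum (d ℕ.+ k) y - expSum k y
    expSum-tail-mono {y} x≤y zero k =
      ≤-reflexive (trans (+-inverseʳ (expSum k x)) (sym (+-inverseʳ (expSum k y))))
    expSum-tail-mono {y} x≤y (suc d) k = begin
      S + s - S₀    ≡⟨ swap S s S₀ ⟩
      S - S₀ + s    ≤⟨ +-mono-≤ (expSum-tail-mono x≤y d k) (expTerm-mono x≤y (d ℕ.+ k)) ⟩
      T - T₀ + t    ≡⟨ swap T t T₀ ⟨
      T + t - T₀    ∎
      where
      open ≤-Reasoning
      S = expSum (d ℕ.+ k) x
      S₀ = expSum k x
      s = expTerm x (d ℕ.+ k)
      T = expSum (d ℕ.+ k) y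
      T₀ = expSum k y
      t = expTerm y (d ℕ.+ k)
      swap : ∀ a b c → a + b - c ≡ a - c + b
      swap = solve 3 (λ a b c → a :+ b :- c := a :- c :+ b) refl

  expSum-0 : ∀ k → expSum (suc k) 0ℚ ≡ 1ℚ
  expSum-0 zero    = refl
  expSum-0 (suc k) = begin
    expSum (suc k) 0ℚ + 0ℚ * 0ℚ ^ k * c   ≡⟨ cong₂ _+_ (expSum-0 k) (solve 2 (λ p c → con 0ℚ :* p :* c := con 0ℚ) refl (0ℚ ^ k) c) ⟩
    1ℚ                                    ∎
    where
    open ≡-Reasoning
    c = (+ 1 / suc k !) {{suc k ℕ.!≢0}}

  -- Both sides satisfy (n + 1) c (n + 1) = (y + z) c n.
  expTerm-+ : ∀ y z n → ∑< (suc n) (λ i → expTerm y i * expTerm z (n ℕ.∸ i)) ≡ expTerm (y + z) n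
  expTerm-+ y z zero    = refl
  expTerm-+ y z (suc n) = ι-cancelˡ-≡ (suc n) (begin
    ι (suc n) * ∑< (2 ℕ.+ n) (λ i → s i * t (suc n ℕ.∸ i))
      ≡⟨ ∑<-*ˡ (2 ℕ.+ n) (ι (suc n)) _ ⟨
    ∑< (2 ℕ.+ n) (λ i → ι (suc n) * (s i * t (suc n ℕ.∸ i)))
      ≡⟨ ∑<-cong (2 ℕ.+ n) (λ i i<2+n → split i (ℕ.s≤s⁻¹ i<2+n)) ⟩
    ∑< (2 ℕ.+ n) (λ i → ds i * t (suc n ℕ.∸ i) + s i * dt (suc n ℕ.∸ i))
      ≡⟨ ∑<-+ (2 ℕ.+ n) (λ i → ds i * t (suc n ℕ.∸ i)) (λ i → s i * dt (suc n ℕ.∸ i)) ⟩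
    ∑< (2 ℕ.+ n) (λ i → ds i * t (suc n ℕ.∸ i)) + ∑< (2 ℕ.+ n) (λ i → s i * dt (suc n ℕ.∸ i))
      ≡⟨ cong₂ _+_ left right ⟩
    y * c + z * c
      ≡⟨ *-distribʳ-+ c y z ⟨
    (y + z) * c
      ≡⟨ cong ((y + z) *_) (expTerm-+ y z n) ⟩
    (y + z) * expTerm (y + z) n
      ≡⟨ expTerm-suc (y + z) n ⟨
    ι (suc n) * expTerm (y + z) (suc n) ∎)
    where
    open ≡-Reasoning
    s t ds dt : ℕ → ℚ
    s = expTerm y
    t = expTerm z
    -- Terms weighted by their degree: writing `n + 1` as `i + (n + 1 - i)` gives a product rule,
    -- and `expTerm-suc` lowers the degree of the weighted factor.
    ds i = ι i * s i
    dt i = ι i * t i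
    c = ∑< (suc n) (λ i → s i * t (n ℕ.∸ i))
    split : ∀ i → i ℕ.≤ suc n →
            ι (suc n) * (s i * t (suc n ℕ.∸ i)) ≡ ds i * t (suc n ℕ.∸ i) + s i * dt (suc n ℕ.∸ i)
    split i i≤1+n = begin
      ι (suc n) * (s i * t r)        ≡⟨ cong (λ z → ι z * (s i * t r)) (ℕ.m+[n∸m]≡n i≤1+n) ⟨
      ι (i ℕ.+ r) * (s i * t r)      ≡⟨ cong (_* (s i * t r)) (ι-+ i r) ⟩
      (ι i + ι r) * (s i * t r)      ≡⟨ solve 4 (λ a b s t → (a :+ b) :* (s :* t) := a :* s :* t :+ s :* (b :* t)) refl (ι i) (ι r) (s i) (t r) ⟩
      ds i * t r + s i * dt r        ∎
      where r = suc n ℕ.∸ i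
    left : ∑< (2 ℕ.+ n) (λ i → ds i * t (suc n ℕ.∸ i)) ≡ y * c
    left = begin
      ∑< (2 ℕ.+ n) (λ i → ds i * t (suc n ℕ.∸ i))
        ≡⟨ ∑<-suc (suc n) (λ i → ds i * t (suc n ℕ.∸ i)) ⟩
      ds 0 * t (suc n) + ∑< (suc n) (λ i → ds (suc i) * t (n ℕ.∸ i))
        ≡⟨ cong₂ _+_ (*-zeroˡ (t (suc n))) (∑<-cong (suc n) λ i _ →
             trans (cong (_* t (n ℕ.∸ i)) (expTerm-suc y i)) (*-assoc y (s i) (t (n ℕ.∸ i)))) ⟩
      0ℚ + ∑< (suc n) (λ i → y * (s i * t (n ℕ.∸ i)))
        ≡⟨ +-identityˡ _ ⟩
      ∑< (suc n) (λ i → y * (s i * t (n ℕ.∸ i)))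
        ≡⟨ ∑<-*ˡ (suc n) y _ ⟩
      y * c ∎
    right : ∑< (2 ℕ.+ n) (λ i → s i * dt (suc n ℕ.∸ i)) ≡ z * c
    right = begin
      ∑< (suc n) (λ i → s i * dt (suc n ℕ.∸ i)) + s (suc n) * dt (n ℕ.∸ n)
        ≡⟨ cong₂ _+_ (∑<-cong (suc n) shift) (cong (λ r → s (suc n) * dt r) (ℕ.n∸n≡0 n)) ⟩
      ∑< (suc n) (λ i → z * (s i * t (n ℕ.∸ i))) + s (suc n) * 0ℚ
        ≡⟨ cong₂ _+_ (∑<-*ˡ (suc n) z _) (*-zeroʳ (s (suc n))) ⟩
      z * c + 0ℚ
        ≡⟨ +-identityʳ (z * c) ⟩
      z * c ∎
      where
      shift : ∀ i → i ℕ.< suc n → s i * dt (suc n ℕ.∸ i) ≡ z * (s i * t (n ℕ.∸ i))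
      shift i i<1+n = begin
        s i * dt (suc n ℕ.∸ i)        ≡⟨ cong (λ r → s i * dt r) (ℕ.+-∸-assoc 1 (ℕ.s≤s⁻¹ i<1+n)) ⟩
        s i * dt (suc (n ℕ.∸ i))      ≡⟨ cong (s i *_) (expTerm-suc z (n ℕ.∸ i)) ⟩
        s i * (z * t (n ℕ.∸ i))       ≡⟨ solve 3 (λ s z t → s :* (z :* t) := z :* (s :* t)) refl (s i) z (t (n ℕ.∸ i)) ⟩
        z * (s i * t (n ℕ.∸ i))       ∎

  -- The left side is the sum of the products of degrees `i + j < k`. Raising `k` by one adds the
  -- diagonal `i + j = k`, which is `expTerm-+`.
  expSum-+ : ∀ y z k → ∑< k (λ i → expTerm y i * expSum (k ℕ.∸ i) z) ≡ expSum k (y + z)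
  expSum-+ y z zero    = refl
  expSum-+ y z (suc k) = begin
    ∑< (suc k) (λ i → s i * S (suc k ℕ.∸ i))
      ≡⟨ ∑<-cong (suc k) split ⟩
    ∑< (suc k) (λ i → s i * S (k ℕ.∸ i) + s i * expTerm z (k ℕ.∸ i))
      ≡⟨ ∑<-+ (suc k) (λ i → s i * S (k ℕ.∸ i)) _ ⟩
    (∑< k (λ i → s i * S (k ℕ.∸ i)) + s k * S (k ℕ.∸ k)) + ∑< (suc k) (λ i → s i * expTerm z (k ℕ.∸ i))
      ≡⟨ cong₂ _+_ (cong₂ _+_ (expSum-+ y z k) (trans (cong (λ r → s k * S r) (ℕ.n∸n≡0 k)) (*-zeroʳ (s k)))) (expTerm-+ y z k) ⟩
    (expSum k (y + z) + 0ℚ) + expTerm (y + z) k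
      ≡⟨ cong (_+ expTerm (y + z) k) (+-identityʳ (expSum k (y + z))) ⟩
    expSum (suc k) (y + z) ∎
    where
    open ≡-Reasoning
    s S : ℕ → ℚ
    s = expTerm y
    S r = expSum r z
    split : ∀ i → i ℕ.< suc k → s i * S (suc k ℕ.∸ i) ≡ s i * S (k ℕ.∸ i) + s i * expTerm z (k ℕ.∸ i)
    split i i<1+k = trans (cong (λ r → s i * S r) (ℕ.+-∸-assoc 1 (ℕ.s≤s⁻¹ i<1+k)))
      (*-distribˡ-+ (s i) (S (k ℕ.∸ i)) (expTerm z (k ℕ.∸ i)))

  -- The terms of the product of total degree at least k are dominated by
  -- those of the tail of exp (2 x).
  expSum-neg-* : ∀ {x} → 0ℚ ≤ x → ∀ {k l} → suc k ℕ.≤ l →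
    expSum (suc k) (- x) * expSum l x ≤ 1ℚ + (expSum (l ℕ.+ suc k) (x + x) - expSum (suc k) (x + x))
  expSum-neg-* {x} 0≤x {k′} {l} k≤l = begin
    expSum k (- x) * L
      ≡⟨ ∑<-*ʳ k L n ⟨
    ∑< k (λ i → n i * L)
      ≤⟨ ∑<-mono k term ⟩
    ∑< k (λ i → n i * S (k ℕ.∸ i) + (p i * L + - 1ℚ * (p i * S (k ℕ.∸ i))))
      ≡⟨ ∑<-+ k (λ i → n i * S (k ℕ.∸ i)) _ ⟩
    ∑< k (λ i → n i * S (k ℕ.∸ i)) + ∑< k (λ i → p i * L + - 1ℚ * (p i * S (k ℕ.∸ i)))
      ≡⟨ cong₂ _+_ (trans (expSum-+ (- x) x k) (trans (cong (expSum k) (+-inverseˡ x)) (expSum-0 k′)))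
                   (∑<-+ k (λ i → p i * L) _) ⟩
    1ℚ + (∑< k (λ i → p i * L) + ∑< k (λ i → - 1ℚ * (p i * S (k ℕ.∸ i))))
      ≤⟨ +-monoʳ-≤ 1ℚ (+-mono-≤ low (≤-reflexive (trans (∑<-*ˡ k (- 1ℚ) _) (cong (- 1ℚ *_) (expSum-+ x x k))))) ⟩
    1ℚ + (expSum (l ℕ.+ k) (x + x) + - 1ℚ * expSum k (x + x))
      ≡⟨ cong (_+_ 1ℚ) (solve 2 (λ a b → a :+ con (- 1ℚ) :* b := a :- b) refl (expSum (l ℕ.+ k) (x + x)) (expSum k (x + x))) ⟩
    1ℚ + (expSum (l ℕ.+ k) (x + x) - expSum k (x + x)) ∎
    where
    open ≤-Reasoning
    k = suc k′
    L = expSum l x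
    n p S : ℕ → ℚ
    n = expTerm (- x)
    p = expTerm x
    S r = expSum r x
    term : ∀ i → i ℕ.< k → n i * L ≤ n i * S (k ℕ.∸ i) + (p i * L + - 1ℚ * (p i * S (k ℕ.∸ i)))
    -- `L` is split at degree `k - i`: the lower part of the products sums to `expSum k 0ℚ`, and in
    -- the upper part the factor `L - S (k - i)` is nonnegative, so `- x` may be replaced by `x`.
    term i _ = begin
      n i * L
        ≡⟨ solve 3 (λ n L S → n :* L := n :* S :+ n :* (L :- S)) refl (n i) L (S (k ℕ.∸ i)) ⟩
      n i * S (k ℕ.∸ i) + n i * (L - S (k ℕ.∸ i))
        ≤⟨ +-monoʳ-≤ (n i * S (k ℕ.∸ i)) (*-monoʳ-≤-nonNeg (L - S (k ℕ.∸ i)) {{nonNegative diff}} (expTerm-neg-≤ 0≤x i)) ⟩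
      n i * S (k ℕ.∸ i) + p i * (L - S (k ℕ.∸ i))
        ≡⟨ cong (_+_ (n i * S (k ℕ.∸ i))) (solve 3 (λ p L S → p :* (L :- S) := p :* L :+ con (- 1ℚ) :* (p :* S)) refl (p i) L (S (k ℕ.∸ i))) ⟩
      n i * S (k ℕ.∸ i) + (p i * L + - 1ℚ * (p i * S (k ℕ.∸ i))) ∎
      where
      diff : 0ℚ ≤ L - S (k ℕ.∸ i)
      diff = subst (_≤ L - S (k ℕ.∸ i)) (+-inverseʳ (S (k ℕ.∸ i)))
        (+-monoˡ-≤ (- S (k ℕ.∸ i)) (∑<-extend-≤ (0≤expTerm 0≤x) (ℕ.≤-trans (ℕ.m∸n≤m k i) k≤l)))
    -- The rectangle `i < k`, `j < l` lies inside the triangle `i + j < l + k`.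
    low : ∑< k (λ i → p i * L) ≤ expSum (l ℕ.+ k) (x + x)
    low = begin
      ∑< k (λ i → p i * L)
        ≤⟨ ∑<-mono k (λ i i<k → *-monoˡ-≤-nonNeg (p i) {{nonNegative (0≤expTerm 0≤x i)}}
             (∑<-extend-≤ (0≤expTerm 0≤x) (subst (l ℕ.≤_) (sym (ℕ.+-∸-assoc l (ℕ.<⇒≤ i<k))) (ℕ.m≤m+n l (k ℕ.∸ i))))) ⟩
      ∑< k (λ i → p i * S (l ℕ.+ k ℕ.∸ i))
        ≤⟨ ∑<-extend l k (λ i → 0≤expTerm 0≤x i ×₊ 0≤expSum 0≤x (l ℕ.+ k ℕ.∸ i)) ⟩
      ∑< (l ℕ.+ k) (λ i → p i * S (l ℕ.+ k ℕ.∸ i))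
        ≡⟨ expSum-+ x x (l ℕ.+ k) ⟩
      expSum (l ℕ.+ k) (x + x) ∎

  p≤∣p∣ : ∀ p → p ≤ abs p
  p≤∣p∣ p with ≤-total 0ℚ p
  ... | inj₁ h = ≤-reflexive (sym (0≤p⇒∣p∣≡p h))
  ... | inj₂ h = ≤-trans h (0≤∣p∣ p)

  expSum-cauchy : ∀ x → IsCauchy (λ k → expSum k x)
  expSum-cauchy x = isCauchy (exp (fromℚ x))

  -- The tail at `X + X` dominates the tails at `x + x`. One `N` has to serve all `x` up to `X`,
  -- because the argument used later varies with `k`.
  expSum-neg-*-≤ : ∀ X ε → 0ℚ < ε → ∃ λ N → ∀ x k l → 0ℚ ≤ x → x ≤ X → N ℕ.≤ k → k ℕ.≤ l →
    expSum k (- x) * expSum l x ≤ 1ℚ + ε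
  expSum-neg-*-≤ X ε ε>0 = bound (expSum-cauchy (X + X) ε ε>0)
    where
    open ≤-Reasoning
    bound : (∃ λ N → ∀ i j → N ℕ.≤ i → N ℕ.≤ j → abs (expSum i (X + X) - expSum j (X + X)) ≤ ε) →
            ∃ λ N → ∀ x k l → 0ℚ ≤ x → x ≤ X → N ℕ.≤ k → k ℕ.≤ l → expSum k (- x) * expSum l x ≤ 1ℚ + ε
    -- `suc N` forces `k` to be a successor, the form that `expSum-neg-*` needs.
    bound (N , H) = suc N , go
      where
      go : ∀ x k l → 0ℚ ≤ x → x ≤ X → suc N ℕ.≤ k → k ℕ.≤ l → expSum k (- x) * expSum l x ≤ 1ℚ + ε
      go x (suc k) l 0≤x x≤X N<k k≤l = begin
        expSum (suc k) (- x) * expSum l x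
          ≤⟨ expSum-neg-* 0≤x k≤l ⟩
        1ℚ + (expSum (l ℕ.+ suc k) (x + x) - expSum (suc k) (x + x))
          ≤⟨ +-monoʳ-≤ 1ℚ (expSum-tail-mono (+-mono-≤ 0≤x 0≤x) (+-mono-≤ x≤X x≤X) l (suc k)) ⟩
        1ℚ + (expSum (l ℕ.+ suc k) (X + X) - expSum (suc k) (X + X))
          ≤⟨ +-monoʳ-≤ 1ℚ (≤-trans (p≤∣p∣ _) (H (l ℕ.+ suc k) (suc k) (ℕ.≤-trans N≤k (ℕ.m≤n+m (suc k) l)) N≤k)) ⟩
        1ℚ + ε ∎
        where
        N≤k : N ℕ.≤ suc k
        N≤k = ℕ.<⇒≤ N<k

  -- Lower bounds for partial sums of exp at harmonic segments

  module _ {a x} (0≤a : 0ℚ ≤ a) (0≤x : 0ℚ ≤ x) where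

    -- The left side is the part of degree at most one in `a` of the binomial expansion of the right
    -- side; the other terms are nonnegative.
    expTerm-bernoulli : ∀ j → expTerm x (suc j) + a * expTerm x j ≤ expTerm (a + x) (suc j)
    expTerm-bernoulli zero = ≤-reflexive
      (solve 2 (λ a x → x :* con 1ℚ :* con 1ℚ :+ a :* (con 1ℚ :* con 1ℚ) := (a :+ x) :* con 1ℚ :* con 1ℚ) refl a x)
    expTerm-bernoulli (suc j) = ι-cancelˡ-≤ (2 ℕ.+ j) (begin
      ι (2 ℕ.+ j) * (T″ + a * T′)
        ≡⟨ *-distribˡ-+ (ι (2 ℕ.+ j)) T″ (a * T′) ⟩
      ι (2 ℕ.+ j) * T″ + ι (2 ℕ.+ j) * (a * T′)
        ≡⟨ cong₂ _+_ (expTerm-suc x (suc j)) (cong (_* (a * T′)) (ι-+ 1 (suc j))) ⟩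
      x * T′ + (1ℚ + ι (suc j)) * (a * T′)
        ≡⟨ solve 4 (λ x a n t → x :* t :+ (con 1ℚ :+ n) :* (a :* t) := (a :+ x) :* t :+ a :* (n :* t)) refl x a (ι (suc j)) T′ ⟩
      (a + x) * T′ + a * (ι (suc j) * T′)
        ≡⟨ cong (λ z → (a + x) * T′ + a * z) (expTerm-suc x j) ⟩
      (a + x) * T′ + a * (x * T)
        ≡⟨ +-identityʳ _ ⟨
      (a + x) * T′ + a * (x * T) + 0ℚ
        -- The added nonnegative square term in `a` completes the product with `a + x`.
        ≤⟨ +-monoʳ-≤ ((a + x) * T′ + a * (x * T)) (0≤a ×₊ (0≤a ×₊ 0≤expTerm 0≤x j)) ⟩
      (a + x) * T′ + a * (x * T) + a * (a * T)
        ≡⟨ solve 4 (λ x a t s → (a :+ x) :* t :+ a :* (x :* s) :+ a :* (a :* s) := (a :+ x) :* (t :+ a :* s)) refl x a T′ T ⟩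
      (a + x) * (T′ + a * T)
        ≤⟨ *-monoˡ-≤-nonNeg (a + x) {{nonNegative (+-mono-≤ 0≤a 0≤x)}} (expTerm-bernoulli j) ⟩
      (a + x) * expTerm (a + x) (suc j)
        ≡⟨ expTerm-suc (a + x) (suc j) ⟨
      ι (2 ℕ.+ j) * expTerm (a + x) (2 ℕ.+ j) ∎)
      where
      open ≤-Reasoning
      T = expTerm x j
      T′ = expTerm x (suc j)
      T″ = expTerm x (2 ℕ.+ j)

    private
      expSum-bernoulli⁺ : ∀ k → expSum (suc k) x + a * expSum k x ≤ expSum (suc k) (a + x)
      expSum-bernoulli⁺ zero    = ≤-reflexive (solve 1 (λ a → con 1ℚ :+ a :* con 0ℚ := con 1ℚ) refl a)
      expSum-bernoulli⁺ (suc k) = begin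
        expSum (suc k) x + T′ + a * (expSum k x + T)
          ≡⟨ solve 5 (λ a S′ S t′ t → S′ :+ t′ :+ a :* (S :+ t) := S′ :+ a :* S :+ (t′ :+ a :* t)) refl a (expSum (suc k) x) (expSum k x) T′ T ⟩
        expSum (suc k) x + a * expSum k x + (T′ + a * T)
          ≤⟨ +-mono-≤ (expSum-bernoulli⁺ k) (expTerm-bernoulli k) ⟩
        expSum (2 ℕ.+ k) (a + x) ∎
        where
        open ≤-Reasoning
        T = expTerm x k
        T′ = expTerm x (suc k)

    -- A finite form of (1 + a) exp x ≤ exp (a + x). The factor `1ℚ + a` raises the degree by one,
    -- hence the extra term on the right.
    expSum-bernoulli : ∀ k → (1ℚ + a) * expSum k x ≤ expSum (suc k) (a + x)
    expSum-bernoulli k = begin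
      (1ℚ + a) * expSum k x               ≡⟨ solve 2 (λ a S → (con 1ℚ :+ a) :* S := S :+ a :* S) refl a (expSum k x) ⟩
      expSum k x + a * expSum k x         ≤⟨ +-monoˡ-≤ (a * expSum k x) (∑<-extend 1 k (0≤expTerm 0≤x)) ⟩
      expSum (suc k) x + a * expSum k x   ≤⟨ expSum-bernoulli⁺ k ⟩
      expSum (suc k) (a + x)              ∎
      where open ≤-Reasoning

  -- `logSeq (suc p) k` unfolds to `segment k (p * k)`.
  segment : ℕ → ℕ → ℚ
  segment a r = ∑< r λ i → + 1 / suc (a ℕ.+ i)

  0≤segment : ∀ a r → 0ℚ ≤ segment a r
  0≤segment a r = 0≤∑< r λ i → 0≤/ 1 (suc (a ℕ.+ i))

  -- ∏ (1 + 1/(a+1+i)) telescopes to (a+1+r)/(a+1).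
  expSum-segment : ∀ a r {x} → 0ℚ ≤ x → ∀ j →
    expSum j x * ι (suc (a ℕ.+ r)) ≤ expSum (r ℕ.+ j) (segment a r + x) * ι (suc a)
  expSum-segment a zero {x} 0≤x j = ≤-reflexive
    (cong₂ (λ y n → expSum j y * ι (suc n)) (sym (+-identityˡ x)) (ℕ.+-identityʳ a))
  expSum-segment a (suc r) {x} 0≤x j = begin
    expSum j x * ι (suc (a ℕ.+ suc r))
      ≡⟨ cong (expSum j x *_) telescope ⟩
    expSum j x * (n * (1ℚ + u))
      ≡⟨ *-assoc (expSum j x) n (1ℚ + u) ⟨
    expSum j x * n * (1ℚ + u)
      ≤⟨ *-monoʳ-≤-nonNeg (1ℚ + u) {{nonNegative (+-mono-≤ (0≤/ 1 1) 0≤u)}} (expSum-segment a r 0≤x j) ⟩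
    expSum (r ℕ.+ j) y * ι (suc a) * (1ℚ + u)
      ≡⟨ solve 3 (λ e b v → e :* b :* v := v :* e :* b) refl (expSum (r ℕ.+ j) y) (ι (suc a)) (1ℚ + u) ⟩
    (1ℚ + u) * expSum (r ℕ.+ j) y * ι (suc a)
      ≤⟨ *-monoʳ-≤-nonNeg (ι (suc a)) {{nonNegative (0≤ι (suc a))}} (expSum-bernoulli 0≤u (+-mono-≤ (0≤segment a r) 0≤x) (r ℕ.+ j)) ⟩
    expSum (suc r ℕ.+ j) (u + y) * ι (suc a)
      ≡⟨ cong (λ z → expSum (suc r ℕ.+ j) z * ι (suc a)) (solve 3 (λ u s x → u :+ (s :+ x) := s :+ u :+ x) refl u (segment a r) x) ⟩
    expSum (suc r ℕ.+ j) (segment a (suc r) + x) * ι (suc a) ∎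
    where
    open ≤-Reasoning
    n = ι (suc (a ℕ.+ r))
    u = + 1 / suc (a ℕ.+ r)
    y = segment a r + x
    0≤u = 0≤/ 1 (suc (a ℕ.+ r))
    telescope : ι (suc (a ℕ.+ suc r)) ≡ n * (1ℚ + u)
    telescope = begin-equality
      ι (suc (a ℕ.+ suc r))      ≡⟨ cong (ι ∘ suc) (ℕ.+-suc a r) ⟩
      ι (suc (suc (a ℕ.+ r)))    ≡⟨ ι-+ 1 (suc (a ℕ.+ r)) ⟩
      1ℚ + n                     ≡⟨ cong (_+ n) (/-*-cancel 1 (suc (a ℕ.+ r))) ⟨
      u * n + n                  ≡⟨ solve 2 (λ u n → u :* n :+ n := n :* (con 1ℚ :+ u)) refl u n ⟩
      n * (1ℚ + u)               ∎

  -- `expSum-segment` iterated `p` times from the one-term sum 1; each round adds a segment to the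
  -- argument and `r` terms to the sum.
  expSum-segment-^ : ∀ a r p →
    ι (suc (a ℕ.+ r) ℕ.^ p) ≤ expSum (p ℕ.* r ℕ.+ 1) (ι p * segment a r) * ι (suc a ℕ.^ p)
  expSum-segment-^ a r zero = ≤-reflexive
    (trans (sym (cong (_* 1ℚ) (expSum-0 0))) (cong (λ z → expSum 1 z * 1ℚ) (sym (*-zeroˡ (segment a r)))))
  expSum-segment-^ a r (suc p) = begin
    ι (A ℕ.* A ℕ.^ p)
      ≡⟨ ι-* A (A ℕ.^ p) ⟩
    ι A * ι (A ℕ.^ p)
      ≤⟨ *-monoˡ-≤-nonNeg (ι A) {{nonNegative (0≤ι A)}} (expSum-segment-^ a r p) ⟩
    ι A * (E * ι (B ℕ.^ p))
      ≡⟨ solve 3 (λ A E B → A :* (E :* B) := E :* A :* B) refl (ι A) E (ι (B ℕ.^ p)) ⟩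
    E * ι A * ι (B ℕ.^ p)
      ≤⟨ *-monoʳ-≤-nonNeg (ι (B ℕ.^ p)) {{nonNegative (0≤ι (B ℕ.^ p))}} (expSum-segment a r (0≤ι p ×₊ 0≤segment a r) (p ℕ.* r ℕ.+ 1)) ⟩
    expSum (r ℕ.+ (p ℕ.* r ℕ.+ 1)) (s + ι p * s) * ι B * ι (B ℕ.^ p)
      ≡⟨ *-assoc (expSum (r ℕ.+ (p ℕ.* r ℕ.+ 1)) (s + ι p * s)) (ι B) (ι (B ℕ.^ p)) ⟩
    expSum (r ℕ.+ (p ℕ.* r ℕ.+ 1)) (s + ι p * s) * (ι B * ι (B ℕ.^ p))
      ≡⟨ cong₂ _*_ (cong₂ expSum (sym (ℕ.+-assoc r (p ℕ.* r) 1)) point) (sym (ι-* B (B ℕ.^ p))) ⟩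
    expSum (suc p ℕ.* r ℕ.+ 1) (ι (suc p) * s) * ι (B ℕ.* B ℕ.^ p) ∎
    where
    open ≤-Reasoning
    A = suc (a ℕ.+ r)
    B = suc a
    s = segment a r
    E = expSum (p ℕ.* r ℕ.+ 1) (ι p * s)
    point : s + ι p * s ≡ ι (suc p) * s
    point = trans (solve 2 (λ s p → s :+ p :* s := (con 1ℚ :+ p) :* s) refl s (ι p)) (cong (_* s) (sym (ι-+ 1 p)))

  -- Comparing `cost` with the cube of Δ

  cube-ratio : ∀ k → 25 ℕ.≤ k → 8 ℕ.* suc k ℕ.^ 3 ℕ.≤ 9 ℕ.* k ℕ.^ 3
  -- 25 is the least `k` with (1 + 1/k)³ ≤ 9/8. After substituting `25 + e` the difference of the
  -- sides is a polynomial with positive coefficients.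
  cube-ratio k h = subst (λ k → 8 ℕ.* suc k ℕ.^ 3 ℕ.≤ 9 ℕ.* k ℕ.^ 3) (ℕ.m+[n∸m]≡n h)
    (ℕ.m+n≤o⇒m≤o _ (ℕ.≤-reflexive (difference (k ℕ.∸ 25))))
    where
    difference : ∀ e → 8 ℕ.* (26 ℕ.+ e) ℕ.^ 3 ℕ.+ (17 ℕ.+ 651 ℕ.* e ℕ.+ 51 ℕ.* (e ℕ.* e) ℕ.+ e ℕ.* (e ℕ.* e))
                     ≡ 9 ℕ.* (25 ℕ.+ e) ℕ.^ 3
    difference = ℕS.solve 1 (λ e →
      ℕS.con 8 ℕS.:* (ℕS.con 26 ℕS.:+ e) ℕS.:^ 3 ℕS.:+
        (ℕS.con 17 ℕS.:+ ℕS.con 651 ℕS.:* e ℕS.:+ ℕS.con 51 ℕS.:* (e ℕS.:* e) ℕS.:+ e ℕS.:* (e ℕS.:* e))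
      ℕS.:= ℕS.con 9 ℕS.:* (ℕS.con 25 ℕS.:+ e) ℕS.:^ 3) refl

  ^-distribʳ-* : ∀ o m n → (m ℕ.* n) ℕ.^ o ≡ m ℕ.^ o ℕ.* n ℕ.^ o
  ^-distribʳ-* zero    m n = refl
  ^-distribʳ-* (suc o) m n = trans (cong (m ℕ.* n ℕ.*_) (^-distribʳ-* o m n))
    (ℕ.[m*n]*[o*p]≡[m*o]*[n*p] m n (m ℕ.^ o) (n ℕ.^ o))

  -- From Δ ≥ 3 comes 2 (Δ + 1) ≤ (8/3) Δ. The constant 8/3 stays below 3 by the factor 9/8 that
  -- `cube-ratio` uses up.
  3*cost≤ : ∀ Δ → 3 ℕ.≤ Δ → 3 ℕ.* cost Δ ℕ.≤ 8 ℕ.* (Δ ℕ.* Δ)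
  3*cost≤ Δ h = begin
    3 ℕ.* cost Δ
      ≡⟨ ℕS.solve 1 (λ Δ → ℕS.con 3 ℕS.:* ((ℕS.con 1 ℕS.:+ Δ) ℕS.:* (Δ ℕS.:* ℕS.con 2))
           ℕS.:= ℕS.con 6 ℕS.:* (Δ ℕS.:* Δ) ℕS.:+ ℕS.con 2 ℕS.:* (ℕS.con 3 ℕS.:* Δ)) refl Δ ⟩
    6 ℕ.* (Δ ℕ.* Δ) ℕ.+ 2 ℕ.* (3 ℕ.* Δ)   ≤⟨ ℕ.+-monoʳ-≤ (6 ℕ.* (Δ ℕ.* Δ)) (ℕ.*-monoʳ-≤ 2 (ℕ.*-monoˡ-≤ Δ h)) ⟩
    6 ℕ.* (Δ ℕ.* Δ) ℕ.+ 2 ℕ.* (Δ ℕ.* Δ)   ≡⟨ ℕ.*-distribʳ-+ (Δ ℕ.* Δ) 6 2 ⟨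
    8 ℕ.* (Δ ℕ.* Δ)                       ∎
    where
    open ℕ.≤-Reasoning

  -- The factors 8/3 and 9/8 multiply to 3, and 3 Δ² k³ ≤ Δ³ k³. So `cost Δ` is at most the cube of
  -- Δk/(k+1), a finite stand-in for exp (3 log Δ).
  cost*cube≤ : ∀ Δ k → 3 ℕ.≤ Δ → 25 ℕ.≤ k → cost Δ ℕ.* suc k ℕ.^ 3 ℕ.≤ (Δ ℕ.* k) ℕ.^ 3
  cost*cube≤ Δ k 3≤Δ 25≤k = ℕ.*-cancelˡ-≤ 3 (begin
    3 ℕ.* (cost Δ ℕ.* suc k ℕ.^ 3)      ≡⟨ ℕ.*-assoc 3 (cost Δ) (suc k ℕ.^ 3) ⟨
    3 ℕ.* cost Δ ℕ.* suc k ℕ.^ 3        ≤⟨ ℕ.*-monoˡ-≤ (suc k ℕ.^ 3) (3*cost≤ Δ 3≤Δ) ⟩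
    8 ℕ.* (Δ ℕ.* Δ) ℕ.* suc k ℕ.^ 3     ≡⟨ swap 8 (Δ ℕ.* Δ) (suc k ℕ.^ 3) ⟩
    Δ ℕ.* Δ ℕ.* (8 ℕ.* suc k ℕ.^ 3)     ≤⟨ ℕ.*-monoʳ-≤ (Δ ℕ.* Δ) (cube-ratio k 25≤k) ⟩
    Δ ℕ.* Δ ℕ.* (9 ℕ.* k ℕ.^ 3)
      ≡⟨ ℕS.solve 2 (λ Δ k → Δ ℕS.:* Δ ℕS.:* (ℕS.con 9 ℕS.:* k ℕS.:^ 3)
           ℕS.:= ℕS.con 3 ℕS.:* (ℕS.con 3 ℕS.:* (Δ ℕS.:* Δ ℕS.:* k ℕS.:^ 3))) refl Δ k ⟩
    3 ℕ.* (3 ℕ.* (Δ ℕ.* Δ ℕ.* k ℕ.^ 3)) ≤⟨ ℕ.*-monoʳ-≤ 3 (ℕ.*-monoˡ-≤ (Δ ℕ.* Δ ℕ.* k ℕ.^ 3) 3≤Δ) ⟩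
    3 ℕ.* (Δ ℕ.* (Δ ℕ.* Δ ℕ.* k ℕ.^ 3))
      ≡⟨ ℕS.solve 2 (λ Δ k → ℕS.con 3 ℕS.:* (Δ ℕS.:* (Δ ℕS.:* Δ ℕS.:* k ℕS.:^ 3))
           ℕS.:= ℕS.con 3 ℕS.:* (Δ ℕS.:* k) ℕS.:^ 3) refl Δ k ⟩
    3 ℕ.* (Δ ℕ.* k) ℕ.^ 3               ∎)
    where
    open ℕ.≤-Reasoning
    swap : ∀ a b c → a ℕ.* b ℕ.* c ≡ b ℕ.* (a ℕ.* c)
    swap = ℕS.solve 3 (λ a b c → a ℕS.:* b ℕS.:* c ℕS.:= b ℕS.:* (a ℕS.:* c)) refl

  -- For `a = k` and `r = p * k`, the ratio in `expSum-segment-^` is (Δk+1)/(k+1), whose cube is at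
  -- least `cost Δ`.
  cost^≤expSum : ∀ p k m → 2 ℕ.≤ p → 25 ℕ.≤ k →
    ι (cost (suc p) ℕ.^ m) ≤ expSum (3 ℕ.* m ℕ.* (p ℕ.* k) ℕ.+ 1) (ι (3 ℕ.* m) * logSeq (suc p) k)
  cost^≤expSum p k m 2≤p 25≤k = *-cancelʳ-≤-pos (ι C) {{normalize-pos C 1}} (begin
    ι (c ℕ.^ m) * ι C     ≡⟨ ι-* (c ℕ.^ m) C ⟨
    ι (c ℕ.^ m ℕ.* C)     ≤⟨ ι-mono powers ⟩
    ι (A ℕ.^ (3 ℕ.* m))   ≤⟨ expSum-segment-^ k (p ℕ.* k) (3 ℕ.* m) ⟩
    expSum (3 ℕ.* m ℕ.* (p ℕ.* k) ℕ.+ 1) (ι (3 ℕ.* m) * logSeq (suc p) k) * ι C ∎)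
    where
    open ≤-Reasoning
    c = cost (suc p)
    A = suc (k ℕ.+ p ℕ.* k)
    B = suc k
    C = B ℕ.^ (3 ℕ.* m)
    instance
      _ = ℕ.m^n≢0 B (3 ℕ.* m)
    powers : c ℕ.^ m ℕ.* C ℕ.≤ A ℕ.^ (3 ℕ.* m)
    powers = subst₂ ℕ._≤_
      (trans (^-distribʳ-* m c (B ℕ.^ 3)) (cong (c ℕ.^ m ℕ.*_) (ℕ.^-*-assoc B 3 m)))
      (ℕ.^-*-assoc A 3 m)
      (ℕ.^-monoˡ-≤ m (ℕ.≤-trans (cost*cube≤ (suc p) k (ℕ.s≤s 2≤p) 25≤k) (ℕ.^-monoˡ-≤ 3 (ℕ.n≤1+n (suc p ℕ.* k)))))

  -- From the partial sums to `exp` and `log`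

  logSeq-bounded : ∀ m .{{_ : ℕ.NonZero m}} → ∃ λ C → ∃ λ N → ∀ k → N ℕ.≤ k → logSeq m k ≤ C
  logSeq-bounded m@(suc _) = bound (isCauchy (log m) 1ℚ (positive⁻¹ 1ℚ))
    where
    open ≤-Reasoning
    bound : (∃ λ N → ∀ i j → N ℕ.≤ i → N ℕ.≤ j → abs (logSeq m i - logSeq m j) ≤ 1ℚ) →
            ∃ λ C → ∃ λ N → ∀ k → N ℕ.≤ k → logSeq m k ≤ C
    bound (N , H) = 1ℚ + logSeq m N , N , λ k N≤k → begin
      logSeq m k                                    ≡⟨ solve 2 (λ a b → a := (a :- b) :+ b) refl (logSeq m k) (logSeq m N) ⟩
      (logSeq m k - logSeq m N) + logSeq m N        ≤⟨ +-monoˡ-≤ (logSeq m N) (≤-trans (p≤∣p∣ _) (H k N N≤k ℕ.≤-refl)) ⟩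
      1ℚ + logSeq m N                               ∎

  -- From e E ≤ 1 + ε and E ≥ W ≥ 1.
  ≤1/n+ : ∀ W .{{_ : ℕ.NonZero W}} {e E ε} → 0ℚ ≤ ε → ι W ≤ E → e * E ≤ 1ℚ + ε → e ≤ + 1 / W + ε
  ≤1/n+ W {e} {E} {ε} 0≤ε W≤E h with ≤-total e 0ℚ
  ... | inj₁ e≤0 = ≤-trans e≤0 (+-mono-≤ (0≤/ 1 W) 0≤ε)
  ... | inj₂ 0≤e = *-cancelʳ-≤-pos (ι W) {{normalize-pos W 1}} (begin
    e * ι W                    ≤⟨ *-monoˡ-≤-nonNeg e {{nonNegative 0≤e}} W≤E ⟩
    e * E                      ≤⟨ h ⟩
    1ℚ + ε                     ≡⟨ cong (_+_ 1ℚ) (*-identityʳ ε) ⟨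
    1ℚ + ε * 1ℚ                ≤⟨ +-monoʳ-≤ 1ℚ (*-monoˡ-≤-nonNeg ε {{nonNegative 0≤ε}} (ι-mono {1} {W} (ℕ.>-nonZero⁻¹ W))) ⟩
    1ℚ + ε * ι W               ≡⟨ cong (_+ ε * ι W) (/-*-cancel 1 W) ⟨
    (+ 1 / W) * ι W + ε * ι W  ≡⟨ *-distribʳ-+ (ι W) (+ 1 / W) ε ⟨
    (+ 1 / W + ε) * ι W        ∎)
    where open ≤-Reasoning

  -- With m blocks the graph has m (Δ + 1) ≥ m Δ vertices, so 3n/Δ is at least 3m.
  exponent-≥ : ∀ Δ .{{_ : ℕ.NonZero Δ}} m → ι (3 ℕ.* m) ≤ (+ 3 / Δ) * ι (m ℕ.* suc Δ)
  exponent-≥ Δ m = begin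
    ι (3 ℕ.* m)                   ≡⟨ ι-* 3 m ⟩
    ι 3 * ι m                     ≡⟨ cong (_* ι m) (/-*-cancel 3 Δ) ⟨
    (+ 3 / Δ) * ι Δ * ι m         ≡⟨ solve 3 (λ a b c → a :* b :* c := a :* (c :* b)) refl (+ 3 / Δ) (ι Δ) (ι m) ⟩
    (+ 3 / Δ) * (ι m * ι Δ)       ≡⟨ cong (_*_ (+ 3 / Δ)) (ι-* m Δ) ⟨
    (+ 3 / Δ) * ι (m ℕ.* Δ)       ≤⟨ *-monoˡ-≤-nonNeg (+ 3 / Δ) {{nonNegative (0≤/ 3 Δ)}} (ι-mono (ℕ.*-monoʳ-≤ m (ℕ.n≤1+n Δ))) ⟩
    (+ 3 / Δ) * ι (m ℕ.* suc Δ)   ∎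
    where open ≤-Reasoning

  -- Put x = q L for the k-th Riemann sum L. The product of `expSum k (- x)` and `expSum l x` is at
  -- most 1 + ε while the second factor is at least `W`, so the first is at most 1/W + ε.
  exp-log-≤ : ∀ Δ .{{_ : ℕ.NonZero Δ}} → 3 ℕ.≤ Δ → ∀ m {q s} .{{_ : ℕ.NonZero (cost Δ ℕ.^ m)}} →
    ι (3 ℕ.* m) ≤ q → + 1 / (cost Δ ℕ.^ m) ≤ s → exp ((- q) · log Δ) ≤ᴿ fromℚ s
  exp-log-≤ Δ@(suc p) (ℕ.s≤s 2≤p) m {q} {s} 3m≤q 1/W≤s ε ε>0 = eventually (logSeq-bounded Δ)
    where
    open ≤-Reasoning
    W = cost Δ ℕ.^ m
    0≤q : 0ℚ ≤ q
    0≤q = ≤-trans (0≤ι (3 ℕ.* m)) 3m≤q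
    eventually : (∃ λ C → ∃ λ N → ∀ k → N ℕ.≤ k → logSeq Δ k ≤ C) →
              ∃ λ N → ∀ k → N ℕ.≤ k → expSum k (- q * logSeq Δ k) ≤ s + ε
    eventually (C , N₁ , L≤C) = N , go
      where
      tails = expSum-neg-*-≤ (q * C) ε ε>0
      N₂ = proj₁ tails
      -- 25 serves `cube-ratio`, `N₁` the bound on the Riemann sums, and `N₂` the product estimate.
      N = 25 ℕ.⊔ (N₁ ℕ.⊔ N₂)
      go : ∀ k → N ℕ.≤ k → expSum k (- q * logSeq Δ k) ≤ s + ε
      go k N≤k = begin
        expSum k (- q * L)       ≡⟨ cong (expSum k) (neg-distribˡ-* q L) ⟨
        expSum k (- (q * L))     ≤⟨ ≤1/n+ W (<⇒≤ ε>0) lower (proj₂ tails (q * L) k l 0≤qL qL≤qC N₂≤k k≤l) ⟩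
        + 1 / W + ε              ≤⟨ +-monoˡ-≤ ε 1/W≤s ⟩
        s + ε                    ∎
        where
        L = logSeq Δ k
        0≤L = 0≤segment k (p ℕ.* k)
        j = 3 ℕ.* m ℕ.* (p ℕ.* k) ℕ.+ 1
        -- At least `j`, for the lower bound by `W`, and at least `k`, for the product estimate.
        l = j ℕ.+ k
        25≤k = ℕ.≤-trans (ℕ.m≤m⊔n 25 (N₁ ℕ.⊔ N₂)) N≤k
        N₁⊔N₂≤k = ℕ.≤-trans (ℕ.m≤n⊔m 25 (N₁ ℕ.⊔ N₂)) N≤k
        N₂≤k = ℕ.≤-trans (ℕ.m≤n⊔m N₁ N₂) N₁⊔N₂≤k
        k≤l = ℕ.m≤n+m k j
        0≤qL = 0≤q ×₊ 0≤L
        qL≤qC = *-monoˡ-≤-nonNeg q {{nonNegative 0≤q}} (L≤C k (ℕ.≤-trans (ℕ.m≤m⊔n N₁ N₂) N₁⊔N₂≤k))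
        lower : ι W ≤ expSum l (q * L)
        lower = begin
          ι W                            ≤⟨ cost^≤expSum p k m 2≤p 25≤k ⟩
          expSum j (ι (3 ℕ.* m) * L)     ≤⟨ expSum-mono (0≤ι (3 ℕ.* m) ×₊ 0≤L) (*-monoʳ-≤-nonNeg L {{nonNegative 0≤L}} 3m≤q) j ⟩
          expSum j (q * L)               ≤⟨ ∑<-extend-≤ (0≤expTerm 0≤qL) (ℕ.m≤m+n j k) ⟩
          expSum l (q * L)               ∎

  Pr-≥ : ∀ {A : Set} {P : Pred A 0ℓ} (P? : Unary.Decidable P) xs W .{{_ : ℕ.NonZero W}} →
    (∃ λ x → x ∈ xs) → length xs ℕ.≤ length (filter P? xs) ℕ.* W → + 1 / W ≤ Pr P? xs
  Pr-≥ P? xs@(_ ∷ _) W _ h = /-mono-≤ 1 W (length (filter P? xs)) (length xs)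
    (subst (ℕ._≤ length (filter P? xs) ℕ.* W) (sym (ℕ.*-identityˡ (length xs))) h)

open import Data.Nat.Base using (NonZero; _≤_)
open import Data.Rational.Base using (_/_; -_; _*_)

proposition4 : (n₀ Δ : ℕ) .{{_ : NonZero Δ}} → 3 ≤ Δ →
    Σ ℕ λ n → n₀ ≤ n ×
    Σ (Graph n) λ G →
    Connected G × Regular G Δ ×
    exp ((- ((+ 3 / Δ) * (+ n / 1))) · log Δ) ≤ᴿ fromℚ (Pr (frozen? G) (Ω G (suc Δ)))
proposition4 n₀ Δ@(suc (suc e)) 3≤Δ@(ℕ.s≤s (ℕ.s≤s _)) =
  -- The necklace has `suc n₀` blocks, so it is nonempty and has at least `n₀` vertices.
  order , ℕ.≤-trans (ℕ.n≤1+n n₀) (ℕ.m≤m*n (suc n₀) (suc Δ)) , necklace , necklace-connected , necklace-regular ,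
  exp-log-≤ Δ 3≤Δ (suc n₀) (exponent-≥ Δ (suc n₀))
    (Pr-≥ (frozen? necklace) (Ω necklace (suc Δ)) (cost Δ ℕ.^ suc n₀) Ω-nonempty length-Ω-≤)
  where
  open Necklace n₀ e
  open Analysis
  instance
    _ = ℕ.m^n≢0 (cost Δ) (suc n₀)
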